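{- Let $G_\bullet$ be a transitive $\mathrm{FI}$-graph. Then the family of simple random walks on the graphs $G_n$ does not exhibit cutoff.
   Context: $\mathrm{FI}$ denotes the category whose objects are the sets $[n]=\{1,\dots,n\}$ ($n\ge 0$) and whose morphisms are injective maps. An $\mathrm{FI}$-set is a functor $Z_\bullet$ from $\mathrm{FI}$ to finite sets; write $Z_n=Z_\bullet([n])$, which carries an induced action of the symmetric group $\mathfrak{S}_n$. $Z_\bullet$ is finitely generated in degree $\le d$ if for all $n\ge d$, $Z_{n+1}=\bigcup_f Z(f)(Z_n)$, the union over all injections $f:[n]\hookrightarrow[n+1]$. An $\mathrm{FI}$-graph $G_\bullet$ is a functor from $\mathrm{FI}$ to the category of finite graphs and graph homomorphisms; equivalently, a vertex $\mathrm{FI}$-set $V_\bullet$ together with a symmetric edge relation $E_\bullet$, i.e. a sub-$\mathrm{FI}$-set of $V_\bullet\times V_\bullet$ (a natural transformation $E_\bullet\to V_\bullet\times V_\bullet$ injective in each degree). All graphs are assumed connected. $G_\bullet$ is finitely generated if its vertex $\mathrm{FI}$-set is finitely generated (in some degree). $G_\bullet$ is transitive if it is finitely generated and for all $n\gg 0$ the action of $\mathfrak{S}_n$ on $V_n$ is transitive. The simple random walk on a graph moves from a vertex $y$ to each neighbor of $y$ with probability $1/\deg(y)$. For a family of irreducible aperiodic Markov chains $X^{(n)}_t$ with stationary distributions $\pi^{(n)}$, the mixing time $t_{\mathrm{mix}}^{(n)}(\epsilon)$ is the smallest $t$ such that for every starting state the total variation distance $\frac12\sum_x|P^t(x_0,x)-\pi^{(n)}(x)|$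 is at most $\epsilon$. The family mixes in eventually constant time if $t_{\mathrm{mix}}^{(n)}(\epsilon)=O(1)$ for every $\epsilon\in(0,1)$. The family exhibits cutoff if it does not mix in eventually constant time and for all $\epsilon\in(0,1)$, $\lim_{n\to\infty} t_{\mathrm{mix}}^{(n)}(\epsilon)/t_{\mathrm{mix}}^{(n)}(1-\epsilon)=1$. -}

module Defs where

open import Data.Nat as ℕ using (ℕ; zero; suc)
open import Data.Fin using (Fin; _≟_)
open import Data.Bool using (Bool; true; false; if_then_else_)
open import Data.Integer using (+_)
open import Data.Rational as ℚ using (ℚ; 0ℚ; 1ℚ; ½; _/_; _*_; _+_; _-_; ∣_∣; _≤_; _<_)
open import Data.Product using (Σ; ∃; ∃-syntax; _×_)
open import Function.Bundles using (_↣_; Injection)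
open import Relation.Binary.PropositionalEquality using (_≡_)
open import Relation.Nullary using (¬_; yes; no)

open Injection using (to)

-- FI-sets.  The finite set Z_n is represented as Fin (card n); the
-- morphisms of FI are injections Fin m ↣ Fin n.

record FISet : Set where
  field
    card : ℕ → ℕ
    act  : ∀ {m n} → (Fin m ↣ Fin n) → Fin (card m) → Fin (card n)
    -- functoriality (stated pointwise, so Z(f) only depends on the map f)
    act-id   : ∀ {n} (h : Fin n ↣ Fin n) → (∀ i → to h i ≡ i) →
               ∀ x → act h x ≡ x
    act-comp : ∀ {l m n} (f : Fin l ↣ Fin m) (g : Fin m ↣ Fin n)
               (h : Fin l ↣ Fin n) → (∀ i → to h i ≡ to g (to f i)) →
               ∀ x → act h x ≡ act g (act f x)

GeneratedInDegree : FISet → ℕ → Set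
GeneratedInDegree Z d =
  ∀ n → d ℕ.≤ n → ∀ (z : Fin (card (suc n))) →
    ∃[ f ] ∃[ w ] (act {n} {suc n} f w ≡ z)
  where open FISet Z

FinitelyGenerated : FISet → Set
FinitelyGenerated Z = ∃[ d ] GeneratedInDegree Z d

-- FI-graphs: a vertex FI-set with a symmetric edge relation that is a
-- sub-FI-set of V × V (i.e. preserved by all FI-maps).

record FIGraph : Set where
  field
    V     : FISet
  open FISet V public
  field
    adj      : ∀ n → Fin (card n) → Fin (card n) → Bool
    adj-sym  : ∀ n x y → adj n x y ≡ adj n y x
    adj-hom  : ∀ {m n} (f : Fin m ↣ Fin n) x y → adj m x y ≡ true →
               adj n (act f x) (act f y) ≡ true

module _ (G : FIGraph) where
  open FIGraph G

  data Reach (n : ℕ) : Fin (card n) → Fin (card n) → Set where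
    here : ∀ {x} → Reach n x x
    step : ∀ {x y z} → adj n x y ≡ true → Reach n y z → Reach n x z

  Connected : Set
  Connected = ∀ n (x y : Fin (card n)) → Reach n x y

  -- transitive: finitely generated and S_n acts transitively for n ≫ 0
  -- (an injection Fin n ↣ Fin n is a permutation)
  Transitive : Set
  Transitive = FinitelyGenerated V ×
    ∃[ N ] (∀ n → N ℕ.≤ n → ∀ (x y : Fin (card n)) →
              ∃[ σ ] (act {n} {n} σ x ≡ y))

sumℚ : ∀ {k} → (Fin k → ℚ) → ℚ
sumℚ {zero}  f = 0ℚ
sumℚ {suc k} f = f Fin.zero + sumℚ (λ i → f (Fin.suc i))

sumℕ : ∀ {k} → (Fin k → ℕ) → ℕ
sumℕ {zero}  f = 0
sumℕ {suc k} f = f Fin.zero ℕ.+ sumℕ (λ i → f (Fin.suc i))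

inv : ℕ → ℚ
inv zero    = 0ℚ
inv (suc k) = + 1 / suc k

fromℕ : ℕ → ℚ
fromℕ k = + k / 1

module SRW (G : FIGraph) (n : ℕ) where
  open FIGraph G

  Vx : Set
  Vx = Fin (card n)

  deg : Vx → ℕ
  deg y = sumℕ (λ z → if adj n y z then 1 else 0)

  P : Vx → Vx → ℚ
  P y z = if adj n y z then inv (deg y) else 0ℚ

  Pt : ℕ → Vx → Vx → ℚ
  Pt zero    x y with x ≟ y
  ... | yes _ = 1ℚ
  ... | no  _ = 0ℚ
  Pt (suc t) x y = sumℚ (λ z → Pt t x z * P z y)

  IsStationary : (Vx → ℚ) → Set
  IsStationary π = (∀ x → 0ℚ ≤ π x) × (sumℚ π ≡ 1ℚ) ×
                   (∀ z → sumℚ (λ y → π y * P y z) ≡ π z)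

  TV : (Vx → ℚ) → ℕ → Vx → ℚ
  TV π t x0 = ½ * sumℚ (λ x → ∣ Pt t x0 x - π x ∣)

  MixedBy : ℚ → ℕ → Set
  MixedBy ε t = ∀ π → IsStationary π → ∀ x0 → TV π t x0 ≤ ε

  IsMixingTime : ℚ → ℕ → Set
  IsMixingTime ε t = MixedBy ε t × (∀ s → MixedBy ε s → t ℕ.≤ s)

InUnit : ℚ → Set
InUnit ε = (0ℚ < ε) × (ε < 1ℚ)

MixesInEventuallyConstantTime : FIGraph → Set
MixesInEventuallyConstantTime G =
  ∀ ε → InUnit ε → ∃[ C ] ∃[ N ] (∀ n → N ℕ.≤ n → ∀ t →
    SRW.IsMixingTime G n ε t → t ℕ.≤ C)

-- t_mix(ε)/t_mix(1-ε) → 1, written as |t − s| ≤ δ·s to avoid division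
Cutoff : FIGraph → Set
Cutoff G = ¬ MixesInEventuallyConstantTime G ×
  (∀ ε → InUnit ε → ∀ δ → 0ℚ < δ → ∃[ N ] (∀ n → N ℕ.≤ n → ∀ t s →
     SRW.IsMixingTime G n ε t → SRW.IsMixingTime G n (1ℚ - ε) s →
     ∣ fromℕ t - fromℕ s ∣ ≤ δ * fromℕ s))

module Submission where

-- By transitivity and finite generation, the stabilizer of a vertex x of G n has at
-- most D orbits on the vertices, with D independent of n.  The distributions of
-- the walk started at x are constant on these orbits, so for every step length k
-- the D + 1 distributions u(jk), 0 ≤ j ≤ D, satisfy a linear relation, which
-- persists under shifts of time.  Under cutoff with mixing times tending to
-- infinity, k can be chosen such that u(0), …, u(Dk) are nearly singular to the
-- uniform distribution while all u(ik) with i > D are nearly uniform.  The mass that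
-- the u(ik) give to a suitable set then drops from about 1 to about 0 at a single
-- value of i, and two shifts of the relation placing this drop at its largest
-- coefficient and just before it contradict each other.
--
-- Mixing times exist for large n since any two vertices are joined by a walk of
-- even length: a permutation can move one to the other and fix a third vertex.

open import Defs
open import Algebra.Bundles using (CommutativeRing)
import Algebra.Properties.CommutativeMonoid.Sum as CommutativeMonoidSum
import Algebra.Properties.CommutativeSemigroup as CommutativeSemigroup
import Algebra.Properties.Semiring.Sum as SemiringSum
open import Data.Bool using (Bool; if_then_else_; true; false)
open import Data.Empty using (⊥)
open import Data.Fin using (Fin; zero; suc; toℕ; fromℕ<; _≟_; splitAt; join; combine; funToFin; finToFun; punchIn; punchOut)
open import Data.Fin.Permutation using (Permutation′; _⟨$⟩ʳ_; _⟨$⟩ˡ_; flip; permutation; _∘ₚ_; transpose)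
import Data.Fin.Permutation as Perm
import Data.Fin.Permutation.Components as PC
open import Data.Fin.Properties using (any?; all?; pigeonhole; combine-injective; finToFun-funToFin; punchIn-punchOut)
import Data.Fin.Properties as FinP
import Data.Integer as ℤ
import Data.Integer.Properties as ℤP
open import Data.Nat as ℕ using (ℕ; zero; suc)
import Data.Nat.DivMod as DivMod
import Data.Nat.Properties as ℕP
open import Data.Nat.Tactic.RingSolver using () renaming (solve-∀ to solveℕ-∀)
open import Data.Product using (Σ; ∃-syntax; _×_; _,_; proj₁; proj₂)
open import Data.Rational as ℚ
  using (ℚ; 0ℚ; 1ℚ; ½; _+_; _*_; _-_; -_; ∣_∣; _≤_; _<_; toℚᵘ)
open import Data.Rational.Properties as ℚP using (≤-refl; ≤-trans; ≤-reflexive; +-mono-≤; +-*-commutativeRing)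
open import Data.Rational.Unnormalised as ℚᵘ using (mkℚᵘ)
import Data.Rational.Unnormalised.Properties as ℚᵘP
open import Data.Sum using (_⊎_; inj₁; inj₂; [_,_]′)
open import Data.Vec.Functional using (_∷_; _++_)
open import Function using (_∘_; id)
open import Function.Bundles using (_↣_; Injection; mk↣)
open import Function.Properties.Inverse using (↔⇒↣)
open import Level using (0ℓ)
open import Relation.Binary.Definitions using (tri<; tri≈; tri>)
open import Relation.Binary.PropositionalEquality
open import Relation.Nullary using (¬_; ¬?; Dec; yes; no; does; contradiction)
open import Relation.Nullary.Decidable using (dec⇒maybe)
open import Tactic.RingSolver using (solve-∀)
open import Tactic.RingSolver.Core.AlmostCommutativeRing using (AlmostCommutativeRing; fromCommutativeRing)

open Injection using (to; injective)

private
  module CM = CommutativeMonoidSum ℚP.+-0-commutativeMonoid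
  module CMℕ = CommutativeMonoidSum ℕP.+-0-commutativeMonoid
  module SR = SemiringSum (CommutativeRing.semiring +-*-commutativeRing)

-- Injections and permutations

RefinesKernel : ∀ {m n} → (Fin m → Fin n) → (Fin m → Fin n) → Set
RefinesKernel h h′ = ∀ i j → h i ≡ h j → h′ i ≡ h′ j

transpose-left : ∀ {n} (i j : Fin n) → PC.transpose i j i ≡ j
transpose-left i j with i ≟ i
... | yes _ = refl
... | no i≢i = contradiction refl i≢i

transpose-other : ∀ {n} (i j k : Fin n) → k ≢ i → k ≢ j → PC.transpose i j k ≡ k
transpose-other i j k k≢i k≢j with k ≟ i
... | yes k≡i = contradiction k≡i k≢i
... | no _ with k ≟ j
...   | yes k≡j = contradiction k≡j k≢j
...   | no _ = refl

-- Induction on the length of the tuples. If `h zero` recurs later, the permutation for the tails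
-- already works. Otherwise a transposition corrects the image of `h zero`; the equal kernels ensure
-- that it moves none of the values already placed.
extend-to-permutation : ∀ {m n} (h h′ : Fin m → Fin n) → RefinesKernel h h′ → RefinesKernel h′ h →
                        ∃[ ρ ] (∀ i → ρ ⟨$⟩ʳ h i ≡ h′ i)
extend-to-permutation {zero} h h′ _ _ = Perm.id , λ ()
extend-to-permutation {suc m} h h′ fw bw
  with extend-to-permutation (h ∘ suc) (h′ ∘ suc) (λ i j → fw (suc i) (suc j)) (λ i j → bw (suc i) (suc j))
     | any? (λ j → h zero ≟ h (suc j))
... | ρ , ρ-ok | yes (j , h₀≡hⱼ) = ρ , λ where
        zero    → trans (cong (ρ ⟨$⟩ʳ_) h₀≡hⱼ) (trans (ρ-ok j) (sym (fw zero (suc j) h₀≡hⱼ)))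
        (suc i) → ρ-ok i
... | ρ , ρ-ok | no ¬repeat = ρ ∘ₚ transpose (ρ ⟨$⟩ʳ h zero) (h′ zero) , λ where
        zero    → transpose-left (ρ ⟨$⟩ʳ h zero) (h′ zero)
        (suc i) → trans (cong (PC.transpose (ρ ⟨$⟩ʳ h zero) (h′ zero)) (ρ-ok i))
                    (transpose-other _ _ _
                      (λ e → ¬repeat (i , ρ-injective (trans (sym e) (sym (ρ-ok i)))))
                      (λ e → ¬repeat (i , bw zero (suc i) (sym e))))
  where
  ρ-injective : ∀ {x y} → ρ ⟨$⟩ʳ x ≡ ρ ⟨$⟩ʳ y → x ≡ y
  ρ-injective e = trans (sym (Perm.inverseˡ ρ)) (trans (cong (ρ ⟨$⟩ˡ_) e) (Perm.inverseˡ ρ))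

-- If every point were hit, choosing preimages would map `Fin n` into the smaller `Fin m`, and two
-- distinct points would share a preimage.
missed-point : ∀ {m n} → m ℕ.< n → (h : Fin m → Fin n) → ∃[ y ] (∀ i → h i ≢ y)
missed-point m<n h with FinP.all? (λ y → any? (λ i → h i ≟ y))
... | yes onto = let i , j , i<j , e = pigeonhole m<n (proj₁ ∘ onto) in
        contradiction
          (trans (sym (proj₂ (onto i))) (trans (cong h e) (proj₂ (onto j))))
          (FinP.<⇒≢ i<j)
... | no ¬onto = let y , ¬hit = FinP.¬∀⟶∃¬ _ _ (λ y → any? (λ i → h i ≟ y)) ¬onto in
        y , λ i e → ¬hit (i , e)

disjoint-injection : ∀ k {m n} → k ℕ.+ m ℕ.≤ n → (h : Fin m → Fin n) →
                     Σ (Fin k ↣ Fin n) λ e → ∀ i j → h i ≢ to e j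
disjoint-injection zero _ h = mk↣ {to = λ ()} (λ { {()} }) , λ _ ()
disjoint-injection (suc k) {m} {n} le h
  with missed-point (ℕP.≤-trans (ℕ.s≤s (ℕP.m≤n+m m k)) le) h
... | y , y-missed with disjoint-injection k (subst (ℕ._≤ n) (sym (ℕP.+-suc k m)) le) (y ∷ h)
...   | e , e-disjoint =
        mk↣ {to = y ∷ to e} inj ,
        λ where
          i zero    → y-missed i
          i (suc j) → e-disjoint (suc i) j
  where
  inj : ∀ {i j} → (y ∷ to e) i ≡ (y ∷ to e) j → i ≡ j
  inj {zero}  {zero}  _ = refl
  inj {zero}  {suc j} p = contradiction p (e-disjoint zero j)
  inj {suc i} {zero}  p = contradiction (sym p) (e-disjoint zero i)
  inj {suc i} {suc j} p = cong suc (injective e p)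

-- As `f` is injective and avoids `e`, the only coincidences between distinct positions lie in the
-- block of `e`, which both tuples share.
++-kernel : ∀ {a b n} (f f′ : Fin a ↣ Fin n) (e : Fin b → Fin n) →
            (∀ i j → to f i ≢ e j) → RefinesKernel (to f ++ e) (to f′ ++ e)
++-kernel {a} f f′ e disj i j with splitAt a i | splitAt a j
... | inj₁ i′ | inj₁ j′ = λ p → cong (to f′) (injective f p)
... | inj₁ i′ | inj₂ j′ = λ p → contradiction p (disj i′ j′)
... | inj₂ i′ | inj₁ j′ = λ p → contradiction (sym p) (disj j′ i′)
... | inj₂ i′ | inj₂ j′ = λ p → p

++-agree : ∀ {a b} {n} {A : Set} (f : Fin a → Fin n) (g : Fin b → Fin n) (f′ : Fin a → A) (g′ : Fin b → A) (ρ : Fin n → A) →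
           (∀ i → ρ ((f ++ g) i) ≡ (f′ ++ g′) i) →
           (∀ i → ρ (f i) ≡ f′ i) × (∀ j → ρ (g j) ≡ g′ j)
++-agree {a} {b} f g f′ g′ ρ ok = left , right
  where
  left : ∀ i → ρ (f i) ≡ f′ i
  left i with ok (join a b (inj₁ i))
  ... | p rewrite FinP.splitAt-↑ˡ a i b = p
  right : ∀ j → ρ (g j) ≡ g′ j
  right j with ok (join a b (inj₂ j))
  ... | p rewrite FinP.splitAt-↑ʳ a b j = p

coincide : ∀ {n} → Fin n → Fin n → Fin 2
coincide x y with x ≟ y
... | yes _ = suc zero
... | no _  = zero

coincide-transfer : ∀ {m n} {x y : Fin m} {x′ y′ : Fin n} → coincide x y ≡ coincide x′ y′ → x ≡ y → x′ ≡ y′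
coincide-transfer {x = x} {y} {x′} {y′} e x≡y with x ≟ y | x′ ≟ y′
... | _      | yes x′≡y′ = x′≡y′
... | no x≢y | no _ = contradiction x≡y x≢y
coincide-transfer () x≡y | yes _ | no _

-- The coincidence matrix of the tuple `h`, packed into one number. Its range depends on `m` alone,
-- which is what makes the later orbit count independent of `n`.
kernelCode : ∀ {m n} → (Fin m → Fin n) → Fin ((2 ℕ.^ m) ℕ.^ m)
kernelCode h = funToFin (λ i → funToFin (λ j → coincide (h i) (h j)))

funToFin-injective : ∀ {m n} (f g : Fin m → Fin n) → funToFin f ≡ funToFin g → ∀ i → f i ≡ g i
funToFin-injective f g e i =
  trans (sym (finToFun-funToFin f i)) (trans (cong (λ c → finToFun c i) e) (finToFun-funToFin g i))

kernelCode-refines : ∀ {m n} (h h′ : Fin m → Fin n) → kernelCode h ≡ kernelCode h′ → RefinesKernel h h′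
kernelCode-refines h h′ e i j =
  coincide-transfer (funToFin-injective _ _ (funToFin-injective _ _ e i) j)

-- FI-sets

identity : ∀ {n} → Fin n ↣ Fin n
identity = mk↣ (λ e → e)

module FISetProperties (Z : FISet) where
  open FISet Z

  act-cong : ∀ {m n} (f g : Fin m ↣ Fin n) → (∀ i → to f i ≡ to g i) → ∀ x → act f x ≡ act g x
  act-cong f g f≗g x =
    trans (act-comp identity g f f≗g x) (cong (act g) (act-id identity (λ _ → refl) x))

  act-∘ : ∀ {m n} (f : Fin m ↣ Fin n) (g : Fin m ↣ Fin n) (ρ : Permutation′ n) →
          (∀ i → ρ ⟨$⟩ʳ to f i ≡ to g i) → ∀ w → act (↔⇒↣ ρ) (act f w) ≡ act g w
  act-∘ f g ρ ok w = sym (act-comp f (↔⇒↣ ρ) g (λ i → sym (ok i)) w)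

  actPermutation : ∀ {n} → Permutation′ n → Permutation′ (card n)
  actPermutation ρ = permutation (act (↔⇒↣ ρ)) (act (↔⇒↣ (flip ρ)))
    (λ x → trans (sym (act-comp _ _ identity (λ _ → sym (Perm.inverseʳ ρ)) x)) (act-id identity (λ _ → refl) x))
    (λ x → trans (sym (act-comp _ _ identity (λ _ → sym (Perm.inverseˡ ρ)) x)) (act-id identity (λ _ → refl) x))

  -- Supplies an explicit inverse for `σ`, so that its action becomes a permutation of the vertices
  -- along which sums can be reindexed.
  act-permutation : ∀ {n} (σ : Fin n ↣ Fin n) → ∃[ ρ ] (∀ x → act (↔⇒↣ ρ) x ≡ act σ x)
  act-permutation σ =
    let ρ , ok = extend-to-permutation id (to σ) (λ _ _ → cong (to σ)) (λ _ _ → injective σ)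
    in ρ , act-cong (↔⇒↣ ρ) σ ok

  module _ {d} (gen : GeneratedInDegree Z d) where

    generated : ∀ {n} → d ℕ.≤′ n → (z : Fin (card n)) → ∃[ f ] ∃[ w ] (act {d} {n} f w ≡ z)
    generated (ℕ.≤′-reflexive refl) z = identity , z , act-id identity (λ _ → refl) z
    generated (ℕ.≤′-step d≤n) z with gen _ (ℕP.≤′⇒≤ d≤n) z
    ... | f , w , refl with generated d≤n w
    ...   | g , v , refl = compose , v , act-comp g f compose (λ _ → refl) v
      where compose = mk↣ (λ e → injective g (injective f e))

    -- Number of generators in degree `d` times the number of codes for the kernel of a tuple of
    -- length `d + d`. It bounds the number of orbits of a vertex stabilizer for all `n` at once.
    orbitalBound : ℕ
    orbitalBound = card d ℕ.* (2 ℕ.^ (d ℕ.+ d)) ℕ.^ (d ℕ.+ d)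

    -- Vertices are classified relative to x = act f w: a vertex act g v gets the
    -- generator v together with the coincidence pattern of f and g.
    module _ {n} (d≤n : d ℕ.≤′ n) (x : Fin (card n)) where

      private
        f = proj₁ (generated d≤n x)

        embedding : Fin (card n) → Fin d ↣ Fin n
        embedding y = proj₁ (generated d≤n y)

        pattern′ : Fin (card n) → Fin (d ℕ.+ d) → Fin n
        pattern′ y = to f ++ to (embedding y)

      orbital : Fin (card n) → Fin orbitalBound
      orbital y = combine (proj₁ (proj₂ (generated d≤n y))) (kernelCode (pattern′ y))

      -- Equal coincidence patterns give one `ρ` that fixes the range of `f` pointwise and carries
      -- the embedding of `y` to that of `y′`. The first property fixes `x`; the second moves `y` to
      -- `y′` because their generators agree.
      orbital-conjugate : ∀ y y′ → orbital y ≡ orbital y′ →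
                          ∃[ ρ ] (act (↔⇒↣ ρ) x ≡ x × act (↔⇒↣ ρ) y ≡ y′)
      orbital-conjugate y y′ e =
        ρ , trans (cong (act (↔⇒↣ ρ)) (sym x-eq)) (trans (act-∘ f f ρ (proj₁ agree) _) x-eq)
          , trans (cong (act (↔⇒↣ ρ)) (sym y-eq))
              (trans (act-∘ (embedding y) (embedding y′) ρ (proj₂ agree) _)
                (trans (cong (act (embedding y′)) v≡v′) (proj₂ (proj₂ (generated d≤n y′)))))
        where
        x-eq = proj₂ (proj₂ (generated d≤n x))
        y-eq = proj₂ (proj₂ (generated d≤n y))
        v = proj₁ (proj₂ (generated d≤n y))
        v′ = proj₁ (proj₂ (generated d≤n y′))
        codes = combine-injective v (kernelCode (pattern′ y)) v′ (kernelCode (pattern′ y′)) e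
        v≡v′ : v ≡ v′
        v≡v′ = proj₁ codes
        extension = extend-to-permutation (pattern′ y) (pattern′ y′)
          (kernelCode-refines _ _ (proj₂ codes)) (kernelCode-refines _ _ (sym (proj₂ codes)))
        ρ = proj₁ extension
        agree = ++-agree (to f) (to (embedding y)) (to f) (to (embedding y′)) (ρ ⟨$⟩ʳ_) (proj₂ extension)

    -- With `x = act f w`, the fixed vertex is `act e w` for some `e` whose range avoids those of
    -- `f` and `g = σ ∘ f`. Three blocks of size `d` must fit into `n`. The permutation takes `f` to
    -- `g` and leaves `e` in place.
    fixing-a-point : ∀ {n} → d ℕ.≤′ n → d ℕ.+ (d ℕ.+ d) ℕ.≤ n → (x : Fin (card n)) (σ : Fin n ↣ Fin n) →
                     ∃[ ρ ] ∃[ z ] (act (↔⇒↣ ρ) x ≡ act σ x × act (↔⇒↣ ρ) z ≡ z)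
    fixing-a-point {n} d≤n 3d≤n x σ with generated d≤n x
    ... | f , w , refl = ρ , act e w ,
          trans (act-∘ f g ρ (proj₁ agree) w) (act-comp f σ g (λ _ → refl) w) ,
          act-∘ e e ρ (proj₂ agree) w
      where
      g : Fin d ↣ Fin n
      g = mk↣ (λ p → injective f (injective σ p))
      fresh = disjoint-injection d 3d≤n (to f ++ to g)
      e = proj₁ fresh
      f-disjoint : ∀ i j → to f i ≢ to e j
      f-disjoint i j p = proj₂ fresh (join d d (inj₁ i)) j
        (trans (cong [ to f , to g ]′ (FinP.splitAt-↑ˡ d i d)) p)
      g-disjoint : ∀ i j → to g i ≢ to e j
      g-disjoint i j p = proj₂ fresh (join d d (inj₂ i)) j
        (trans (cong [ to f , to g ]′ (FinP.splitAt-↑ʳ d d i)) p)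
      extension = extend-to-permutation (to f ++ to e) (to g ++ to e)
        (++-kernel f g (to e) f-disjoint) (++-kernel g f (to e) g-disjoint)
      ρ = proj₁ extension
      agree = ++-agree (to f) (to e) (to g) (to e) (ρ ⟨$⟩ʳ_) (proj₂ extension)

ring : AlmostCommutativeRing 0ℓ 0ℓ
ring = fromCommutativeRing +-*-commutativeRing λ p → dec⇒maybe (0ℚ ℚP.≟ p)

-- Ordered field arithmetic in ℚ

0≤q-p⇒p≤q : ∀ {p q} → 0ℚ ≤ q - p → p ≤ q
0≤q-p⇒p≤q {p} {q} 0≤ = subst₂ _≤_ (ℚP.+-identityˡ p) (cancel q p) (ℚP.+-monoˡ-≤ p 0≤)
  where
  cancel : ∀ a b → (a - b) + b ≡ a
  cancel = solve-∀ ring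

p≤q⇒0≤q-p : ∀ {p q} → p ≤ q → 0ℚ ≤ q - p
p≤q⇒0≤q-p {p} {q} p≤q = subst (_≤ q - p) (ℚP.+-inverseʳ p) (ℚP.+-monoˡ-≤ (- p) p≤q)

-- Splits an inequality into a sign condition and an identity that the ring solver can settle.
≤-by : ∀ {p q} r → 0ℚ ≤ r → q - p ≡ r → p ≤ q
≤-by r 0≤r e = 0≤q-p⇒p≤q (subst (0ℚ ≤_) (sym e) 0≤r)

*-monoˡ-≤ : ∀ {r p q} → 0ℚ ≤ r → p ≤ q → r * p ≤ r * q
*-monoˡ-≤ {r} 0≤r = ℚP.*-monoˡ-≤-nonNeg r {{ℚ.nonNegative 0≤r}}

*-monoʳ-≤ : ∀ {r p q} → 0ℚ ≤ r → p ≤ q → p * r ≤ q * r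
*-monoʳ-≤ {r} 0≤r = ℚP.*-monoʳ-≤-nonNeg r {{ℚ.nonNegative 0≤r}}

0≤* : ∀ {p q} → 0ℚ ≤ p → 0ℚ ≤ q → 0ℚ ≤ p * q
0≤* {p} {q} 0≤p 0≤q = subst (_≤ p * q) (ℚP.*-zeroʳ p) (*-monoˡ-≤ 0≤p 0≤q)

0<* : ∀ {p q} → 0ℚ < p → 0ℚ < q → 0ℚ < p * q
0<* {p} {q} 0<p 0<q =
  ℚP.positive⁻¹ (p * q) {{ℚP.pos*pos⇒pos p {{ℚ.positive 0<p}} q {{ℚ.positive 0<q}}}}

0≤∣p∣ : ∀ p → 0ℚ ≤ ∣ p ∣
0≤∣p∣ p = ℚP.nonNegative⁻¹ ∣ p ∣ {{ℚP.∣-∣-nonNeg p}}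

p≤∣p∣ : ∀ p → p ≤ ∣ p ∣
p≤∣p∣ p with ℚP.≤-total 0ℚ p
... | inj₁ 0≤p = ≤-reflexive (sym (ℚP.0≤p⇒∣p∣≡p 0≤p))
... | inj₂ p≤0 = ≤-trans p≤0 (0≤∣p∣ p)

∣p-q∣≡∣q-p∣ : ∀ p q → ∣ p - q ∣ ≡ ∣ q - p ∣
∣p-q∣≡∣q-p∣ p q = trans (cong ∣_∣ (lemma p q)) (ℚP.∣-p∣≡∣p∣ (q - p))
  where
  lemma : ∀ p q → p - q ≡ - (q - p)
  lemma = solve-∀ ring

0<∣p∣ : ∀ {p} → p ≢ 0ℚ → 0ℚ < ∣ p ∣
0<∣p∣ {p} p≢0 = ℚP.≰⇒> λ ∣p∣≤0 → p≢0 (ℚP.∣p∣≡0⇒p≡0 p (ℚP.≤-antisym ∣p∣≤0 (0≤∣p∣ p)))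

*-≢0 : ∀ {p q} → p ≢ 0ℚ → q ≢ 0ℚ → p * q ≢ 0ℚ
*-≢0 {p} {q} p≢0 q≢0 e = ℚP.<-irrefl (sym (trans (sym (ℚP.∣p*q∣≡∣p∣*∣q∣ p q)) (cong ∣_∣ e)))
  (0<* (0<∣p∣ p≢0) (0<∣p∣ q≢0))

toℚᵘ-fromℕ : ∀ n → toℚᵘ (fromℕ n) ℚᵘ.≃ mkℚᵘ (ℤ.+ n) 0
toℚᵘ-fromℕ n = ℚP.toℚᵘ-fromℚᵘ (mkℚᵘ (ℤ.+ n) 0)

fromℕ-+ : ∀ m n → fromℕ (m ℕ.+ n) ≡ fromℕ m + fromℕ n
fromℕ-+ m n = ℚP.toℚᵘ-injective
  (ℚᵘP.≃-trans (toℚᵘ-fromℕ (m ℕ.+ n))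
  (ℚᵘP.≃-trans (ℚᵘ.*≡* (cong (ℤ._* ℤ.1ℤ) (cong₂ ℤ._+_ (sym (ℤP.*-identityʳ (ℤ.+ m))) (sym (ℤP.*-identityʳ (ℤ.+ n))))))
  (ℚᵘP.≃-trans (ℚᵘP.+-cong (ℚᵘP.≃-sym (toℚᵘ-fromℕ m)) (ℚᵘP.≃-sym (toℚᵘ-fromℕ n)))
  (ℚᵘP.≃-sym (ℚP.toℚᵘ-homo-+ (fromℕ m) (fromℕ n))))))

fromℕ-suc : ∀ n → fromℕ (suc n) ≡ 1ℚ + fromℕ n
fromℕ-suc n = fromℕ-+ 1 n

fromℕ-* : ∀ m n → fromℕ (m ℕ.* n) ≡ fromℕ m * fromℕ n
fromℕ-* zero n = sym (ℚP.*-zeroˡ (fromℕ n))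
fromℕ-* (suc m) n = begin
  fromℕ (n ℕ.+ m ℕ.* n)        ≡⟨ fromℕ-+ n (m ℕ.* n) ⟩
  fromℕ n + fromℕ (m ℕ.* n)    ≡⟨ cong (_+_ (fromℕ n)) (fromℕ-* m n) ⟩
  fromℕ n + fromℕ m * fromℕ n  ≡⟨ lemma (fromℕ n) (fromℕ m) ⟩
  (1ℚ + fromℕ m) * fromℕ n     ≡⟨ cong (_* fromℕ n) (fromℕ-suc m) ⟨
  fromℕ (suc m) * fromℕ n      ∎
  where
  open ≡-Reasoning
  lemma : ∀ x y → x + y * x ≡ (1ℚ + y) * x
  lemma = solve-∀ ring

fromℕ-mono-≤ : ∀ {m n} → m ℕ.≤ n → fromℕ m ≤ fromℕ n
fromℕ-mono-≤ {m} {n} m≤n = ℚP.toℚᵘ-cancel-≤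
  (ℚᵘP.≤-respˡ-≃ (ℚᵘP.≃-sym (toℚᵘ-fromℕ m)) (ℚᵘP.≤-respʳ-≃ (ℚᵘP.≃-sym (toℚᵘ-fromℕ n))
    (ℚᵘ.*≤* (ℤP.*-monoʳ-≤-nonNeg (ℤ.+ 1) (ℤ.+≤+ m≤n)))))

fromℕ-mono-< : ∀ {m n} → m ℕ.< n → fromℕ m < fromℕ n
fromℕ-mono-< {m} {n} m<n = ℚP.<-≤-trans
  (subst₂ _<_ (ℚP.+-identityˡ (fromℕ m)) (sym (fromℕ-suc m)) (ℚP.+-monoˡ-< (fromℕ m) (ℚP.positive⁻¹ 1ℚ)))
  (fromℕ-mono-≤ m<n)

fromℕ-cancel-≤ : ∀ {m n} → fromℕ m ≤ fromℕ n → m ℕ.≤ n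
fromℕ-cancel-≤ {m} {n} p with m ℕP.≤? n
... | yes m≤n = m≤n
... | no m≰n = contradiction (ℚP.<-≤-trans (fromℕ-mono-< (ℕP.≰⇒> m≰n)) p) (ℚP.<-irrefl refl)

0≤fromℕ : ∀ n → 0ℚ ≤ fromℕ n
0≤fromℕ n = fromℕ-mono-≤ (ℕ.z≤n {n})

0<inv : ∀ n → 0ℚ < inv (suc n)
0<inv n = ℚP.positive⁻¹ (inv (suc n)) {{ℚP.normalize-pos 1 (suc n)}}

0≤inv : ∀ n → 0ℚ ≤ inv n
0≤inv zero = ≤-refl
0≤inv (suc n) = ℚP.<⇒≤ (0<inv n)

fromℕ*inv : ∀ n → fromℕ (suc n) * inv (suc n) ≡ 1ℚ
fromℕ*inv n = ℚP.toℚᵘ-injective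
  (ℚᵘP.≃-trans (ℚP.toℚᵘ-homo-* (fromℕ (suc n)) (inv (suc n)))
  (ℚᵘP.≃-trans (ℚᵘP.*-cong (toℚᵘ-fromℕ (suc n)) (ℚP.toℚᵘ-fromℚᵘ (mkℚᵘ (ℤ.+ 1) n)))
    (ℚᵘ.*≡* (cong ℤ.+_ (lemma n)))))
  where
  lemma : ∀ n → (suc n ℕ.* 1) ℕ.* 1 ≡ 1 ℕ.* (1 ℕ.* suc n)
  lemma n = trans (ℕP.*-identityʳ _) (trans (ℕP.*-identityʳ _) (sym (trans (ℕP.*-identityˡ _) (ℕP.*-identityˡ _))))

-- The witness ∣numerator∣ + 1 exceeds p, as denominators are at least 1.
archimedean : ∀ p → ∃[ n ] (p < fromℕ n)
archimedean p@record{} = suc ℤ.∣ ℚ.↥ p ∣ , ℚP.≤-<-trans le (fromℕ-mono-< (ℕP.n<1+n ℤ.∣ ℚ.↥ p ∣))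
  where
  m = ℤ.∣ ℚ.↥ p ∣
  ↥≤ : ∀ i → i ℤ.≤ ℤ.+ ℤ.∣ i ∣
  ↥≤ (ℤ.+ _) = ℤP.≤-refl
  ↥≤ (ℤ.-[1+ _ ]) = ℤ.-≤+
  le : p ≤ fromℕ m
  le = ℚP.toℚᵘ-cancel-≤ (ℚᵘP.≤-respʳ-≃ (ℚᵘP.≃-sym (toℚᵘ-fromℕ m)) (ℚᵘ.*≤*
    (subst (ℤ._≤ (ℤ.+ m ℤ.* ℚ.↧ p)) (sym (ℤP.*-identityʳ (ℚ.↥ p)))
      (ℤP.≤-trans (↥≤ (ℚ.↥ p)) (subst (ℤ._≤ ℤ.+ m ℤ.* ℚ.↧ p) (ℤP.*-identityʳ (ℤ.+ m))
        (ℤP.*-monoˡ-≤-nonNeg (ℤ.+ m) (ℤ.+≤+ (ℕ.s≤s ℕ.z≤n))))))))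

-- Finite sums

sumℚ≡sum : ∀ {k} (f : Fin k → ℚ) → sumℚ f ≡ CM.sum f
sumℚ≡sum {zero} f = refl
sumℚ≡sum {suc k} f = cong (f zero +_) (sumℚ≡sum (f ∘ suc))

sum-cong : ∀ {k} {f g : Fin k → ℚ} → (∀ i → f i ≡ g i) → sumℚ f ≡ sumℚ g
sum-cong {zero} e = refl
sum-cong {suc k} e = cong₂ _+_ (e zero) (sum-cong (e ∘ suc))

sum-+ : ∀ {k} (f g : Fin k → ℚ) → sumℚ (λ i → f i + g i) ≡ sumℚ f + sumℚ g
sum-+ f g = trans (sumℚ≡sum (λ i → f i + g i)) (trans (CM.∑-distrib-+ f g) (sym (cong₂ _+_ (sumℚ≡sum f) (sumℚ≡sum g))))

*-sum : ∀ {k} a (f : Fin k → ℚ) → a * sumℚ f ≡ sumℚ (λ i → a * f i)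
*-sum a f = trans (cong (a *_) (sumℚ≡sum f)) (trans (SR.*-distribˡ-sum a f) (sym (sumℚ≡sum (λ i → a * f i))))

sum-* : ∀ {k} (f : Fin k → ℚ) a → sumℚ f * a ≡ sumℚ (λ i → f i * a)
sum-* f a = trans (cong (_* a) (sumℚ≡sum f)) (trans (SR.*-distribʳ-sum a f) (sym (sumℚ≡sum (λ i → f i * a))))

sum-- : ∀ {k} (f g : Fin k → ℚ) → sumℚ (λ i → f i - g i) ≡ sumℚ f - sumℚ g
sum-- f g = begin
  sumℚ (λ i → f i - g i)           ≡⟨ sum-cong (λ i → as-sum (f i) (g i)) ⟩
  sumℚ (λ i → f i + - 1ℚ * g i)    ≡⟨ sum-+ f _ ⟩
  sumℚ f + sumℚ (λ i → - 1ℚ * g i) ≡⟨ cong (sumℚ f +_) (*-sum (- 1ℚ) g) ⟨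
  sumℚ f + - 1ℚ * sumℚ g           ≡⟨ as-sum (sumℚ f) (sumℚ g) ⟨
  sumℚ f - sumℚ g                  ∎
  where
  open ≡-Reasoning
  as-sum : ∀ a b → a - b ≡ a + - 1ℚ * b
  as-sum = solve-∀ ring

sum-swap : ∀ {k l} (f : Fin k → Fin l → ℚ) →
           sumℚ (λ i → sumℚ (λ j → f i j)) ≡ sumℚ (λ j → sumℚ (λ i → f i j))
sum-swap f = trans (inner f) (trans (CM.∑-comm f) (sym (inner (λ j i → f i j))))
  where
  inner : ∀ {k l} (f : Fin k → Fin l → ℚ) →
          sumℚ (λ i → sumℚ (f i)) ≡ CM.sum (λ i → CM.sum (f i))
  inner f = trans (sum-cong (λ i → sumℚ≡sum (f i))) (sumℚ≡sum (λ i → CM.sum (f i)))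

sum-permute : ∀ {k} (f : Fin k → ℚ) (ρ : Permutation′ k) → sumℚ f ≡ sumℚ (λ i → f (ρ ⟨$⟩ʳ i))
sum-permute f ρ = trans (sumℚ≡sum f) (trans (CM.sum-permute f ρ) (sym (sumℚ≡sum (λ i → f (ρ ⟨$⟩ʳ i)))))

sum-const : ∀ k a → sumℚ {k} (λ _ → a) ≡ fromℕ k * a
sum-const zero a = sym (ℚP.*-zeroˡ a)
sum-const (suc k) a = begin
  a + sumℚ {k} (λ _ → a)   ≡⟨ cong (_+_ a) (sum-const k a) ⟩
  a + fromℕ k * a          ≡⟨ lemma a (fromℕ k) ⟩
  (1ℚ + fromℕ k) * a       ≡⟨ cong (_* a) (fromℕ-suc k) ⟨
  fromℕ (suc k) * a        ∎
  where
  open ≡-Reasoning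
  lemma : ∀ x y → x + y * x ≡ (1ℚ + y) * x
  lemma = solve-∀ ring

sum-zero : ∀ {k} (f : Fin k → ℚ) → (∀ i → f i ≡ 0ℚ) → sumℚ f ≡ 0ℚ
sum-zero {k} f e = trans (sum-cong e) (trans (sum-const k 0ℚ) (ℚP.*-zeroʳ (fromℕ k)))

sum-mono : ∀ {k} {f g : Fin k → ℚ} → (∀ i → f i ≤ g i) → sumℚ f ≤ sumℚ g
sum-mono {zero} le = ≤-refl
sum-mono {suc k} le = +-mono-≤ (le zero) (sum-mono (le ∘ suc))

0≤sum : ∀ {k} {f : Fin k → ℚ} → (∀ i → 0ℚ ≤ f i) → 0ℚ ≤ sumℚ f
0≤sum {k} {f} 0≤f = subst (_≤ sumℚ f) (sum-zero {k} (λ _ → 0ℚ) (λ _ → refl)) (sum-mono 0≤f)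

∣sum∣≤sum∣∣ : ∀ {k} (f : Fin k → ℚ) → ∣ sumℚ f ∣ ≤ sumℚ (λ i → ∣ f i ∣)
∣sum∣≤sum∣∣ {zero} f = ≤-refl
∣sum∣≤sum∣∣ {suc k} f = ≤-trans (ℚP.∣p+q∣≤∣p∣+∣q∣ (f zero) (sumℚ (f ∘ suc)))
  (ℚP.+-monoʳ-≤ ∣ f zero ∣ (∣sum∣≤sum∣∣ (f ∘ suc)))

term≤sum : ∀ {k} {f : Fin k → ℚ} → (∀ i → 0ℚ ≤ f i) → ∀ i → f i ≤ sumℚ f
term≤sum {suc k} {f} 0≤f zero = subst (_≤ sumℚ f) (ℚP.+-identityʳ (f zero))
  (ℚP.+-monoʳ-≤ (f zero) (0≤sum (0≤f ∘ suc)))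
term≤sum {suc k} {f} 0≤f (suc i) = ≤-trans (term≤sum (0≤f ∘ suc) i)
  (subst (_≤ sumℚ f) (ℚP.+-identityˡ _) (ℚP.+-monoˡ-≤ _ (0≤f zero)))

indicator : ∀ {P : Set} → Dec P → ℚ
indicator d = if does d then 1ℚ else 0ℚ

δ : ∀ {k} → Fin k → Fin k → ℚ
δ i j = indicator (i ≟ j)

sum-δ : ∀ {k} (i : Fin k) (f : Fin k → ℚ) → sumℚ (λ j → δ i j * f j) ≡ f i
sum-δ {suc k} zero f = trans
  (cong₂ _+_ (ℚP.*-identityˡ (f zero)) (sum-zero _ (λ j → ℚP.*-zeroˡ (f (suc j)))))
  (ℚP.+-identityʳ (f zero))
sum-δ {suc k} (suc i) f = trans (cong₂ _+_ (ℚP.*-zeroˡ (f zero)) (sum-δ i (f ∘ suc))) (ℚP.+-identityˡ _)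

maximum : ∀ {k} (f : Fin (suc k) → ℚ) → ∃[ m ] (∀ i → f i ≤ f m)
maximum {zero} f = zero , λ { zero → ≤-refl }
maximum {suc k} f with maximum (f ∘ suc)
... | m , max with ℚP.≤-total (f zero) (f (suc m))
...   | inj₁ le = suc m , λ { zero → le ; (suc i) → max i }
...   | inj₂ ge = zero , λ { zero → ≤-refl ; (suc i) → ≤-trans (max i) ge }

positive-lower-bound : ∀ {k} (f : Fin k → ℚ) → (∀ i → 0ℚ < f i) → ∃[ α ] (0ℚ < α × (∀ i → α ≤ f i))
positive-lower-bound {zero} f _ = 1ℚ , ℚP.positive⁻¹ 1ℚ , λ ()
positive-lower-bound {suc k} f 0<f with maximum (λ i → - f i)
... | m , max = f m , 0<f m , λ i → ≤-by _ (p≤q⇒0≤q-p (max i)) (lemma (f i) (f m))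
  where
  lemma : ∀ a b → a - b ≡ - b - - a
  lemma = solve-∀ ring

upper-bound : ∀ {k} (f : Fin k → ℕ) → ∃[ b ] (∀ i → f i ℕ.≤ b)
upper-bound {zero} f = 0 , λ ()
upper-bound {suc k} f with upper-bound (f ∘ suc)
... | b , ok = f zero ℕ.+ b , λ where
  zero    → ℕP.m≤m+n (f zero) b
  (suc i) → ℕP.≤-trans (ok i) (ℕP.m≤n+m b (f zero))

-- Linear dependence

-- Gaussian elimination: a coordinate `q` at which the first vector is nonzero is cleared from the
-- other vectors, and the induction hypothesis applies to the remaining coordinates.
linear-dependence : ∀ D (v : Fin (suc D) → Fin D → ℚ) →
                    Σ (Fin (suc D) → ℚ) λ c →
                    (∃[ i ] c i ≢ 0ℚ) × (∀ q → sumℚ (λ i → c i * v i q) ≡ 0ℚ)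
linear-dependence zero v = (λ _ → 1ℚ) , (zero , λ ()) , λ ()
linear-dependence (suc D) v with any? (λ q → ¬? (v zero q ℚP.≟ 0ℚ))
-- The first vector vanishes, so it alone is dependent.
... | no all-zero = δ zero , (zero , λ ()) , λ q →
        trans (sum-δ zero (λ i → v i q)) (decide q)
  where
  decide : ∀ q → v zero q ≡ 0ℚ
  decide q with v zero q ℚP.≟ 0ℚ
  ... | yes e = e
  ... | no ne = contradiction (q , ne) all-zero
... | yes (q , a≢0) = c , (suc i₀ , *-≢0 a≢0 c′≢0) , vanishes
  where
  a = v zero q
  reduced : Fin (suc D) → Fin D → ℚ
  reduced i r = a * v (suc i) (punchIn q r) - v (suc i) q * v zero (punchIn q r)
  IH = linear-dependence D reduced
  c′ = proj₁ IH
  i₀ = proj₁ (proj₁ (proj₂ IH))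
  c′≢0 = proj₂ (proj₁ (proj₂ IH))
  -- Scaling the other coefficients by the pivot `a` avoids division; `c zero` is then forced by
  -- coordinate `q`.
  c : Fin (suc (suc D)) → ℚ
  c zero = - sumℚ (λ i → c′ i * v (suc i) q)
  c (suc i) = a * c′ i
  regroup : ∀ b (w : Fin (suc D) → ℚ) →
            c zero * b + sumℚ (λ i → a * c′ i * w i) ≡ sumℚ (λ i → c′ i * (a * w i - v (suc i) q * b))
  regroup b w = begin
    c zero * b + sumℚ (λ i → a * c′ i * w i)
      ≡⟨ flip-order S b (sumℚ (λ i → a * c′ i * w i)) ⟩
    sumℚ (λ i → a * c′ i * w i) - S * b
      ≡⟨ cong (_-_ (sumℚ (λ i → a * c′ i * w i))) (sum-* (λ i → c′ i * v (suc i) q) b) ⟩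
    sumℚ (λ i → a * c′ i * w i) - sumℚ (λ i → c′ i * v (suc i) q * b)
      ≡⟨ sum-- (λ i → a * c′ i * w i) (λ i → c′ i * v (suc i) q * b) ⟨
    sumℚ (λ i → a * c′ i * w i - c′ i * v (suc i) q * b)
      ≡⟨ sum-cong (λ i → factor a (c′ i) (w i) (v (suc i) q) b) ⟩
    sumℚ (λ i → c′ i * (a * w i - v (suc i) q * b)) ∎
    where
    open ≡-Reasoning
    S = sumℚ (λ i → c′ i * v (suc i) q)
    flip-order : ∀ s b t → - s * b + t ≡ t - s * b
    flip-order = solve-∀ ring
    factor : ∀ a c w x b → a * c * w - c * x * b ≡ c * (a * w - x * b)
    factor = solve-∀ ring
  vanishes : ∀ r → sumℚ (λ i → c i * v i r) ≡ 0ℚ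
  vanishes r with q ≟ r
  ... | yes refl = trans (regroup a (λ i → v (suc i) q))
          (sum-zero _ (λ i → cancel (c′ i) a (v (suc i) q)))
    where
    cancel : ∀ c a x → c * (a * x - x * a) ≡ 0ℚ
    cancel = solve-∀ ring
  ... | no q≢r = subst (λ r → sumℚ (λ i → c i * v i r) ≡ 0ℚ) (punchIn-punchOut q≢r)
          (trans (regroup (v zero r′) (λ i → v (suc i) r′)) (proj₂ (proj₂ IH) (punchOut q≢r)))
    where r′ = punchIn q (punchOut q≢r)

-- Vectors constant on `D` classes live in dimension `D`, whatever `N` is. A coefficient of largest
-- absolute value is singled out for `dominant-term`.
linear-dependence-on-classes :
  ∀ {D N} (class : Fin N → Fin D) (v : Fin (suc D) → Fin N → ℚ) →
  (∀ i y y′ → class y ≡ class y′ → v i y ≡ v i y′) →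
  Σ (Fin (suc D) → ℚ) λ c →
  (∃[ m ] (0ℚ < ∣ c m ∣ × (∀ i → ∣ c i ∣ ≤ ∣ c m ∣))) × (∀ y → sumℚ (λ i → c i * v i y) ≡ 0ℚ)
linear-dependence-on-classes {D} class v const =
  c , (m , ℚP.<-≤-trans (0<∣p∣ c≢0) (max i₀) , max) ,
  λ y → trans (sum-cong (λ i → cong (c i *_) (sym (value-class i y)))) (vanishes (class y))
  where
  value : Fin (suc D) → Fin D → ℚ
  value i q with any? (λ y → class y ≟ q)
  ... | yes (y , _) = v i y
  -- An empty class gets a default value; the conclusion only looks at classes of the form
  -- `class y`.
  ... | no _ = 0ℚ
  value-class : ∀ i y → value i (class y) ≡ v i y
  value-class i y with any? (λ y′ → class y′ ≟ class y)
  ... | yes (y′ , e) = const i y′ y e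
  ... | no none = contradiction (y , refl) none
  dependence = linear-dependence D value
  c = proj₁ dependence
  i₀ = proj₁ (proj₁ (proj₂ dependence))
  c≢0 = proj₂ (proj₁ (proj₂ dependence))
  vanishes = proj₂ (proj₂ dependence)
  m = proj₁ (maximum (λ i → ∣ c i ∣))
  max = proj₂ (maximum (λ i → ∣ c i ∣))

-- A step function does not satisfy a short linear recurrence

-- Since `h` is close to `δ m`, the sum differs from `c m` by at most `k ∣ c m ∣ η`, which is less
-- than `∣ c m ∣`.
dominant-term : ∀ {k} (c h : Fin k → ℚ) m η → 0ℚ < ∣ c m ∣ → (∀ i → ∣ c i ∣ ≤ ∣ c m ∣) →
                (∀ i → ∣ δ m i - h i ∣ ≤ η) → fromℕ k * η < 1ℚ → sumℚ (λ i → c i * h i) ≢ 0ℚ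
dominant-term {k} c h m η 0<c max near small e = ℚP.<-irrefl refl (begin-strict
  ∣ c m ∣                               ≡⟨ cong ∣_∣ rewritten ⟩
  ∣ sumℚ (λ i → c i * (δ m i - h i)) ∣  ≤⟨ ∣sum∣≤sum∣∣ (λ i → c i * (δ m i - h i)) ⟩
  sumℚ (λ i → ∣ c i * (δ m i - h i) ∣)  ≤⟨ sum-mono term ⟩
  sumℚ {k} (λ _ → ∣ c m ∣ * η)          ≡⟨ sum-const k (∣ c m ∣ * η) ⟩
  fromℕ k * (∣ c m ∣ * η)               ≡⟨ shuffle (fromℕ k) ∣ c m ∣ η ⟩
  ∣ c m ∣ * (fromℕ k * η)               <⟨ ℚP.*-monoʳ-<-pos ∣ c m ∣ {{ℚ.positive 0<c}} small ⟩
  ∣ c m ∣ * 1ℚ                          ≡⟨ ℚP.*-identityʳ ∣ c m ∣ ⟩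
  ∣ c m ∣                               ∎)
  where
  open ℚP.≤-Reasoning
  shuffle : ∀ x y z → x * (y * z) ≡ y * (x * z)
  shuffle = solve-∀ ring
  expand : ∀ c d h → c * (d - h) ≡ d * c - c * h
  expand = solve-∀ ring
  rewritten : c m ≡ sumℚ (λ i → c i * (δ m i - h i))
  rewritten = sym (trans (sum-cong (λ i → expand (c i) (δ m i) (h i)))
    (trans (sum-- (λ i → δ m i * c i) (λ i → c i * h i))
    (trans (cong₂ _-_ (sum-δ m c) e) (ℚP.+-identityʳ (c m)))))
  term : ∀ i → ∣ c i * (δ m i - h i) ∣ ≤ ∣ c m ∣ * η
  term i = subst (_≤ ∣ c m ∣ * η) (sym (ℚP.∣p*q∣≡∣p∣*∣q∣ (c i) (δ m i - h i)))
    (≤-trans (*-monoʳ-≤ (0≤∣p∣ (δ m i - h i)) (max i)) (*-monoˡ-≤ (0≤∣p∣ (c m)) (near i)))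

-- The recurrence is applied with the drop of g between D and D + 1 placed at
-- the dominant coefficient and just before it; subtracting isolates c m.
no-abrupt-drop : ∀ {D} (c : Fin (suc D) → ℚ) m → 0ℚ < ∣ c m ∣ → (∀ i → ∣ c i ∣ ≤ ∣ c m ∣) →
                 ∀ (g : ℕ → ℚ) η → fromℕ (suc D) * (η + η) < 1ℚ →
                 (∀ i → i ℕ.≤ D → ∣ g i - 1ℚ ∣ ≤ η) → (∀ i → D ℕ.< i → ∣ g i ∣ ≤ η) →
                 (∀ s → sumℚ (λ j → c j * g (toℕ j ℕ.+ s)) ≡ 0ℚ) → ⊥
no-abrupt-drop {D} c m 0<c max g η small early late recurrence =
  dominant-term c h m (η + η) 0<c max near small
    (trans (sum-cong (λ j → ℚP.*-distribˡ-+ (c j) (g (toℕ j ℕ.+ s)) (- g (toℕ j ℕ.+ suc s))))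
    (trans (sum-cong (λ j → cong (c j * g (toℕ j ℕ.+ s) +_) (sym (ℚP.neg-distribʳ-* (c j) (g (toℕ j ℕ.+ suc s))))))
    (trans (sum-- (λ j → c j * g (toℕ j ℕ.+ s)) (λ j → c j * g (toℕ j ℕ.+ suc s)))
    (cong₂ _-_ (recurrence s) (recurrence (suc s))))))
  where
  -- With this shift index `m` reads `g` at `D`, the last early value, and with `suc s` it reads the
  -- first late one. Only at `m` do the two shifts fall on opposite sides of the drop.
  s = D ℕ.∸ toℕ m
  h : Fin (suc D) → ℚ
  h j = g (toℕ j ℕ.+ s) - g (toℕ j ℕ.+ suc s)
  m+s : toℕ m ℕ.+ s ≡ D
  m+s = ℕP.m+[n∸m]≡n (FinP.toℕ≤pred[n] m)
  difference : ∀ p q → ∣ p ∣ ≤ η → ∣ q ∣ ≤ η → ∣ p - q ∣ ≤ η + η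
  difference p q p≤ q≤ = ≤-trans (ℚP.∣p-q∣≤∣p∣+∣q∣ p q) (+-mono-≤ p≤ q≤)
  both-early : ∀ a b → 0ℚ - (a - b) ≡ (b - 1ℚ) - (a - 1ℚ)
  both-early = solve-∀ ring
  straddling : ∀ a b → 1ℚ - (a - b) ≡ b - (a - 1ℚ)
  straddling = solve-∀ ring
  both-late : ∀ a b → 0ℚ - (a - b) ≡ b - a
  both-late = solve-∀ ring
  near : ∀ j → ∣ δ m j - h j ∣ ≤ η + η
  near j with m ≟ j
  ... | yes refl = subst (λ p → ∣ p ∣ ≤ η + η) (sym (straddling (g (toℕ m ℕ.+ s)) (g (toℕ m ℕ.+ suc s))))
          (difference _ _ (late _ (ℕP.≤-reflexive (sym (trans (ℕP.+-suc (toℕ m) s) (cong suc m+s)))))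
            (early _ (ℕP.≤-reflexive m+s)))
  ... | no m≢j with ℕP.<-cmp (toℕ j) (toℕ m)
  ...   | tri< j<m _ _ = subst (λ p → ∣ p ∣ ≤ η + η) (sym (both-early (g (toℕ j ℕ.+ s)) (g (toℕ j ℕ.+ suc s))))
            (difference _ _ (early _ j+1+s≤D)
              (early _ (ℕP.≤-trans (ℕP.+-monoʳ-≤ (toℕ j) (ℕP.n≤1+n s)) j+1+s≤D)))
    where
    j+1+s≤D : toℕ j ℕ.+ suc s ℕ.≤ D
    j+1+s≤D = subst₂ ℕ._≤_ (sym (ℕP.+-suc (toℕ j) s)) m+s (ℕP.+-monoˡ-≤ s j<m)
  ...   | tri≈ _ j≡m _ = contradiction (sym (FinP.toℕ-injective j≡m)) m≢j
  ...   | tri> _ _ m<j = subst (λ p → ∣ p ∣ ≤ η + η) (sym (both-late (g (toℕ j ℕ.+ s)) (g (toℕ j ℕ.+ suc s))))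
            (difference _ _ (late _ (ℕP.≤-trans D<j+s (ℕP.+-monoʳ-≤ (toℕ j) (ℕP.n≤1+n s)))) (late _ D<j+s))
    where
    D<j+s : D ℕ.< toℕ j ℕ.+ s
    D<j+s = subst (ℕ._< toℕ j ℕ.+ s) m+s (ℕP.+-monoˡ-< s m<j)

-- Vectors, kernels and total variation

norm : ∀ {k} → (Fin k → ℚ) → ℚ
norm w = sumℚ (λ i → ∣ w i ∣)

0≤norm : ∀ {k} (w : Fin k → ℚ) → 0ℚ ≤ norm w
0≤norm w = 0≤sum (λ i → 0≤∣p∣ (w i))

norm-cong : ∀ {k} {v w : Fin k → ℚ} → (∀ i → v i ≡ w i) → norm v ≡ norm w
norm-cong e = sum-cong (λ i → cong ∣_∣ (e i))

IsProbability : ∀ {k} → (Fin k → ℚ) → Set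
IsProbability p = (∀ i → 0ℚ ≤ p i) × sumℚ p ≡ 1ℚ

infixl 7 _⊛_

_⊛_ : ∀ {k l} → (Fin k → ℚ) → (Fin k → Fin l → ℚ) → Fin l → ℚ
(w ⊛ M) y = sumℚ (λ z → w z * M z y)

sum-⊛ : ∀ {k l} (w : Fin k → ℚ) (M : Fin k → Fin l → ℚ) r → (∀ z → sumℚ (M z) ≡ r) →
        sumℚ (w ⊛ M) ≡ sumℚ w * r
sum-⊛ w M r rows = begin
  sumℚ (λ y → sumℚ (λ z → w z * M z y))  ≡⟨ sum-swap (λ y z → w z * M z y) ⟩
  sumℚ (λ z → sumℚ (λ y → w z * M z y))  ≡⟨ sum-cong (λ z → sym (*-sum (w z) (M z))) ⟩
  sumℚ (λ z → w z * sumℚ (M z))          ≡⟨ sum-cong (λ z → cong (w z *_) (rows z)) ⟩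
  sumℚ (λ z → w z * r)                   ≡⟨ sum-* w r ⟨
  sumℚ w * r                             ∎
  where open ≡-Reasoning

-- The triangle inequality in each entry reduces this to the mass of `∣ w ∣ ⊛ M`. The row sum `r` is
-- 1 for the walk itself and `1 - α` for the remainder in `doeblin`.
norm-⊛ : ∀ {k l} (w : Fin k → ℚ) (M : Fin k → Fin l → ℚ) r →
         (∀ z y → 0ℚ ≤ M z y) → (∀ z → sumℚ (M z) ≡ r) → norm (w ⊛ M) ≤ norm w * r
norm-⊛ w M r 0≤M rows = ≤-trans (sum-mono entry) (≤-reflexive (sum-⊛ (λ z → ∣ w z ∣) M r rows))
  where
  entry : ∀ y → ∣ (w ⊛ M) y ∣ ≤ ((λ z → ∣ w z ∣) ⊛ M) y
  entry y = ≤-trans (∣sum∣≤sum∣∣ (λ z → w z * M z y)) (≤-reflexive (sum-cong (λ z →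
    trans (ℚP.∣p*q∣≡∣p∣*∣q∣ (w z) (M z y)) (cong (∣ w z ∣ *_) (ℚP.0≤p⇒∣p∣≡p (0≤M z y))))))

⊛-assoc : ∀ {k l m} (w : Fin k → ℚ) (M : Fin k → Fin l → ℚ) (M′ : Fin l → Fin m → ℚ) y →
          ((w ⊛ M) ⊛ M′) y ≡ (w ⊛ (λ z → M z ⊛ M′)) y
⊛-assoc w M M′ y = begin
  sumℚ (λ v → sumℚ (λ z → w z * M z v) * M′ v y)
    ≡⟨ sum-cong (λ v → sum-* (λ z → w z * M z v) (M′ v y)) ⟩
  sumℚ (λ v → sumℚ (λ z → w z * M z v * M′ v y))
    ≡⟨ sum-swap (λ v z → w z * M z v * M′ v y) ⟩
  sumℚ (λ z → sumℚ (λ v → w z * M z v * M′ v y))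
    ≡⟨ sum-cong (λ z → sum-cong (λ v → ℚP.*-assoc (w z) (M z v) (M′ v y))) ⟩
  sumℚ (λ z → sumℚ (λ v → w z * (M z v * M′ v y)))
    ≡⟨ sum-cong (λ z → sym (*-sum (w z) (λ v → M z v * M′ v y))) ⟩
  sumℚ (λ z → w z * sumℚ (λ v → M z v * M′ v y)) ∎
  where open ≡-Reasoning

⊛-linear : ∀ {k l} (v w : Fin k → ℚ) (M : Fin k → Fin l → ℚ) y →
           ((λ z → v z - w z) ⊛ M) y ≡ (v ⊛ M) y - (w ⊛ M) y
⊛-linear v w M y = trans (sum-cong (λ z → lemma (v z) (w z) (M z y)))
  (sum-- (λ z → v z * M z y) (λ z → w z * M z y))
  where
  lemma : ∀ a b c → (a - b) * c ≡ a * c - b * c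
  lemma = solve-∀ ring

sum-δ-row : ∀ {k} (x : Fin k) → sumℚ (δ x) ≡ 1ℚ
sum-δ-row x = trans (sum-cong (λ y → sym (ℚP.*-identityʳ (δ x y)))) (sum-δ x (λ _ → 1ℚ))

-- On vectors of mass zero, M may be replaced by the nonnegative kernel M − α δ x.
doeblin : ∀ {k} (w : Fin k → ℚ) (M : Fin k → Fin k → ℚ) (x : Fin k) α →
          (∀ z y → 0ℚ ≤ M z y) → (∀ z → sumℚ (M z) ≡ 1ℚ) → (∀ z → α ≤ M z x) →
          sumℚ w ≡ 0ℚ → norm (w ⊛ M) ≤ norm w * (1ℚ - α)
doeblin {k} w M x α 0≤M rows minor mass =
  subst (_≤ norm w * (1ℚ - α)) (sym (norm-cong agree)) (norm-⊛ w R (1ℚ - α) 0≤R R-rows)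
  where
  open ≡-Reasoning
  R : Fin k → Fin k → ℚ
  R z y = M z y - α * δ x y
  0≤R : ∀ z y → 0ℚ ≤ R z y
  0≤R z y with x ≟ y
  ... | yes refl = subst (λ a → 0ℚ ≤ M z x - a) (sym (ℚP.*-identityʳ α)) (p≤q⇒0≤q-p (minor z))
  ... | no _ = subst (λ a → 0ℚ ≤ M z y - a) (sym (ℚP.*-zeroʳ α))
                 (subst (0ℚ ≤_) (sym (ℚP.+-identityʳ (M z y))) (0≤M z y))
  R-rows : ∀ z → sumℚ (R z) ≡ 1ℚ - α
  R-rows z = trans (sum-- (M z) (λ y → α * δ x y)) (cong₂ _-_ (rows z)
    (trans (sym (*-sum α (δ x))) (trans (cong (α *_) (sum-δ-row x)) (ℚP.*-identityʳ α))))
  expand : ∀ a b c → a * (b - c) ≡ a * b - a * c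
  expand = solve-∀ ring
  agree : ∀ y → (w ⊛ M) y ≡ (w ⊛ R) y
  agree y = sym (begin
    sumℚ (λ z → w z * (M z y - α * δ x y))
      ≡⟨ sum-cong (λ z → expand (w z) (M z y) (α * δ x y)) ⟩
    sumℚ (λ z → w z * M z y - w z * (α * δ x y))
      ≡⟨ sum-- (λ z → w z * M z y) (λ z → w z * (α * δ x y)) ⟩
    (w ⊛ M) y - sumℚ (λ z → w z * (α * δ x y))
      ≡⟨ cong (_-_ ((w ⊛ M) y)) (trans (sym (sum-* w (α * δ x y)))
           (trans (cong (_* (α * δ x y)) mass) (ℚP.*-zeroˡ (α * δ x y)))) ⟩
    (w ⊛ M) y - 0ℚ
      ≡⟨ ℚP.+-identityʳ ((w ⊛ M) y) ⟩
    (w ⊛ M) y ∎)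

-- Geometrically contracting sequences

multiple-exceeds : ∀ {a} → 0ℚ < a → ∀ b → ∃[ n ] (b ≤ fromℕ n * a)
multiple-exceeds {a} 0<a b = n , (begin
  b                      ≡⟨ ℚP.*-identityʳ b ⟨
  b * 1ℚ                 ≡⟨ cong (b *_) (ℚP.*-inverseˡ a) ⟨
  b * (ℚ.1/ a * a)       ≡⟨ ℚP.*-assoc b (ℚ.1/ a) a ⟨
  b * ℚ.1/ a * a         ≤⟨ *-monoʳ-≤ (ℚP.<⇒≤ 0<a) (ℚP.<⇒≤ (proj₂ bound)) ⟩
  fromℕ n * a            ∎)
  where
  open ℚP.≤-Reasoning
  instance _ = ℚP.pos⇒nonZero a {{ℚ.positive 0<a}}
  bound = archimedean (b * ℚ.1/ a)
  n = proj₁ bound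

-- While the sequence stays above `ε`, each step loses at least `α * ε`. This linear decay suffices
-- and avoids estimating powers of `1 - α`.
contracting-drop : ∀ (a : ℕ → ℚ) α → 0ℚ < α → (∀ j → a (suc j) ≤ a j * (1ℚ - α)) →
                   ∀ ε j → (∃[ i ] a i ≤ ε) ⊎ (a j ≤ a 0 - fromℕ j * (α * ε))
contracting-drop a α 0<α contract ε zero =
  inj₂ (≤-reflexive (sym (trans (cong (_-_ (a 0)) (ℚP.*-zeroˡ (α * ε))) (ℚP.+-identityʳ (a 0)))))
contracting-drop a α 0<α contract ε (suc j) with contracting-drop a α 0<α contract ε j
... | inj₁ found = inj₁ found
... | inj₂ aj≤ with ℚP.≤-total (a j) ε
...   | inj₁ small = inj₁ (j , small)
...   | inj₂ large = inj₂ (begin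
        a (suc j)                              ≤⟨ contract j ⟩
        a j * (1ℚ - α)                         ≤⟨ ≤-by _ (0≤* (ℚP.<⇒≤ 0<α) (p≤q⇒0≤q-p large)) (loss (a j) α ε) ⟩
        a j - α * ε                            ≤⟨ ℚP.+-monoˡ-≤ (- (α * ε)) aj≤ ⟩
        a 0 - fromℕ j * (α * ε) - α * ε        ≡⟨ collect (a 0) (fromℕ j) (α * ε) ⟩
        a 0 - (1ℚ + fromℕ j) * (α * ε)         ≡⟨ cong (λ n → a 0 - n * (α * ε)) (fromℕ-suc j) ⟨
        a 0 - fromℕ (suc j) * (α * ε)          ∎)
  where
  open ℚP.≤-Reasoning
  loss : ∀ x α ε → x - α * ε - x * (1ℚ - α) ≡ α * (x - ε)
  loss = solve-∀ ring
  collect : ∀ x n d → x - n * d - d ≡ x - (1ℚ + n) * d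
  collect = solve-∀ ring

contracting-sequence : ∀ (a : ℕ → ℚ) α → 0ℚ < α → (∀ j → a (suc j) ≤ a j * (1ℚ - α)) →
                       ∀ ε → 0ℚ < ε → ∃[ j ] a j ≤ ε
contracting-sequence a α 0<α contract ε 0<ε =
  conclude (multiple-exceeds (0<* 0<α 0<ε) (a 0))
  where
  lemma : ∀ x y → 0ℚ - (x - y) ≡ y - x
  lemma = solve-∀ ring
  conclude : ∃[ J ] (a 0 ≤ fromℕ J * (α * ε)) → ∃[ j ] a j ≤ ε
  conclude (J , J-large) with contracting-drop a α 0<α contract ε J
  ... | inj₁ found = found
  ... | inj₂ aJ≤ = J , ≤-trans aJ≤ (≤-trans {j = 0ℚ}
          (≤-by {q = 0ℚ} _ (p≤q⇒0≤q-p J-large) (lemma (a 0) (fromℕ J * (α * ε)))) (ℚP.<⇒≤ 0<ε))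

-- The minimum of p and q, in the form that sums to 1 − TV.
common : ℚ → ℚ → ℚ
common p q = ½ * (p + q - ∣ p - q ∣)

common-≤ : ∀ {p q} → p ≤ q → common p q ≡ p
common-≤ {p} {q} p≤q = trans
  (cong (λ d → ½ * (p + q - d)) (trans (∣p-q∣≡∣q-p∣ p q) (ℚP.0≤p⇒∣p∣≡p (p≤q⇒0≤q-p p≤q)))) (lemma p q)
  where
  lemma : ∀ p q → ½ * (p + q - (q - p)) ≡ p
  lemma = solve-∀ ring

common-≥ : ∀ {p q} → q ≤ p → common p q ≡ q
common-≥ {p} {q} q≤p = trans
  (cong (λ d → ½ * (p + q - d)) (ℚP.0≤p⇒∣p∣≡p (p≤q⇒0≤q-p q≤p))) (lemma p q)
  where
  lemma : ∀ p q → ½ * (p + q - (p - q)) ≡ q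
  lemma = solve-∀ ring

0≤common : ∀ {p q} → 0ℚ ≤ p → 0ℚ ≤ q → 0ℚ ≤ common p q
0≤common {p} {q} 0≤p 0≤q with ℚP.≤-total p q
... | inj₁ p≤q = subst (0ℚ ≤_) (sym (common-≤ p≤q)) 0≤p
... | inj₂ q≤p = subst (0ℚ ≤_) (sym (common-≥ q≤p)) 0≤q

tv : ∀ {k} → (Fin k → ℚ) → (Fin k → ℚ) → ℚ
tv p q = ½ * norm (λ i → p i - q i)

sum-common : ∀ {k} {p q : Fin k → ℚ} → IsProbability p → IsProbability q →
              sumℚ (λ i → common (p i) (q i)) ≡ 1ℚ - tv p q
sum-common {k} {p} {q} (_ , Σp) (_ , Σq) = begin
  sumℚ (λ i → ½ * (p i + q i - ∣ p i - q i ∣))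
    ≡⟨ *-sum ½ (λ i → p i + q i - ∣ p i - q i ∣) ⟨
  ½ * sumℚ (λ i → p i + q i - ∣ p i - q i ∣)
    ≡⟨ cong (½ *_) (sum-- (λ i → p i + q i) (λ i → ∣ p i - q i ∣)) ⟩
  ½ * (sumℚ (λ i → p i + q i) - N)
    ≡⟨ cong (λ s → ½ * (s - N)) (trans (sum-+ p q) (cong₂ _+_ Σp Σq)) ⟩
  ½ * (1ℚ + 1ℚ - N)
    ≡⟨ lemma N ⟩
  1ℚ - ½ * N ∎
  where
  open ≡-Reasoning
  N = norm (λ i → p i - q i)
  lemma : ∀ x → ½ * (1ℚ + 1ℚ - x) ≡ 1ℚ - ½ * x
  lemma = solve-∀ ring

-- A is the set of points where some early distribution dominates π: it carries
-- almost all the mass of every early distribution and almost no mass of π.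
no-abrupt-mixing :
  ∀ {D k} (c : Fin (suc D) → ℚ) m → 0ℚ < ∣ c m ∣ → (∀ i → ∣ c i ∣ ≤ ∣ c m ∣) →
  (u : ℕ → Fin k → ℚ) (π : Fin k → ℚ) → (∀ i → IsProbability (u i)) → IsProbability π →
  (∀ s y → sumℚ (λ j → c j * u (toℕ j ℕ.+ s) y) ≡ 0ℚ) →
  ∀ ε → fromℕ (suc D) * (fromℕ (D ℕ.+ 3) * ε + fromℕ (D ℕ.+ 3) * ε) < 1ℚ →
  (∀ i → i ℕ.≤ D → 1ℚ - ε ≤ tv (u i) π) → (∀ i → D ℕ.< i → tv (u i) π ≤ ε) → ⊥
no-abrupt-mixing {D} {k} c m 0<c max u π u-prob π-prob recurrence ε small early late =
  no-abrupt-drop c m 0<c max g η small g-early g-late g-recurrence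
  where
  -- The set `A` has `π`-mass at most `(D + 1) ε`, and a further `2 ε` comes from turning `tv` into
  -- the full norm in `g-late`.
  η = fromℕ (D ℕ.+ 3) * ε
  dominated? : ∀ y → Dec (∃[ j ] π y ≤ u (toℕ {suc D} j) y)
  dominated? y = any? (λ j → π y ℚP.≤? u (toℕ j) y)
  A : Fin k → ℚ
  A y = indicator (dominated? y)
  g : ℕ → ℚ
  g i = sumℚ (λ y → A y * u i y)
  0≤A : ∀ y → 0ℚ ≤ A y
  0≤A y with does (dominated? y)
  ... | true = ℚP.nonNegative⁻¹ 1ℚ
  ... | false = ≤-refl
  A≤1 : ∀ y → A y ≤ 1ℚ
  A≤1 y with does (dominated? y)
  ... | true = ≤-refl
  ... | false = ℚP.nonNegative⁻¹ 1ℚ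
  0≤g : ∀ i → 0ℚ ≤ g i
  0≤g i = 0≤sum (λ y → 0≤* (0≤A y) (proj₁ (u-prob i) y))
  g≤1 : ∀ i → g i ≤ 1ℚ
  g≤1 i = subst (g i ≤_) (proj₂ (u-prob i)) (sum-mono (λ y →
    subst (A y * u i y ≤_) (ℚP.*-identityˡ (u i y)) (*-monoʳ-≤ (proj₁ (u-prob i) y) (A≤1 y))))
  0≤ov : ∀ i y → 0ℚ ≤ common (u i y) (π y)
  0≤ov i y = 0≤common (proj₁ (u-prob i) y) (proj₁ π-prob y)
  common≤ε : ∀ i → i ℕ.≤ D → sumℚ (λ y → common (u i y) (π y)) ≤ ε
  common≤ε i i≤D = subst (_≤ ε) (sym (sum-common (u-prob i) π-prob))
    (≤-by _ (p≤q⇒0≤q-p (early i i≤D)) (lemma ε (tv (u i) π)))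
    where
    lemma : ∀ a b → a - (1ℚ - b) ≡ b - (1ℚ - a)
    lemma = solve-∀ ring
  -- The sign of `ε` is not assumed; it follows from the overlap at time 0.
  0≤ε : 0ℚ ≤ ε
  0≤ε = ≤-trans (0≤sum (0≤ov 0)) (common≤ε 0 ℕ.z≤n)
  -- Outside `A` every early distribution lies below `π`, so all of its mass there counts as overlap
  -- with `π`.
  off-A : ∀ i → i ℕ.≤ D → ∀ y → (1ℚ - A y) * u i y ≤ common (u i y) (π y)
  off-A i i≤D y = decide (dominated? y)
    where
    decide : (d : Dec (∃[ j ] π y ≤ u (toℕ {suc D} j) y)) → (1ℚ - indicator d) * u i y ≤ common (u i y) (π y)
    decide (yes _) = ≤-trans (≤-reflexive (ℚP.*-zeroˡ (u i y))) (0≤ov i y)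
    decide (no none) = ≤-reflexive (trans (ℚP.*-identityˡ (u i y)) (sym (common-≤ u≤π)))
      where
      u≤π : u i y ≤ π y
      u≤π with ℚP.≤-total (u i y) (π y)
      ... | inj₁ le = le
      ... | inj₂ ge = contradiction
            (Data.Fin.fromℕ< (ℕ.s≤s i≤D) , subst (λ j → π y ≤ u j y) (sym (FinP.toℕ-fromℕ< (ℕ.s≤s i≤D))) ge) none
  -- At a point of `A` some early index `j` has `π` below `u j`, and there the overlap with that one
  -- distribution is all of `π y`.
  on-A : ∀ y → A y * π y ≤ sumℚ {suc D} (λ j → common (u (toℕ j) y) (π y))
  on-A y = decide (dominated? y)
    where
    decide : (d : Dec (∃[ j ] π y ≤ u (toℕ {suc D} j) y)) →
             indicator d * π y ≤ sumℚ {suc D} (λ j → common (u (toℕ j) y) (π y))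
    decide (yes (j , π≤u)) = ≤-trans
          (≤-reflexive (trans (ℚP.*-identityˡ (π y)) (sym (common-≥ π≤u))))
          (term≤sum (λ j → 0≤ov (toℕ j) y) j)
    decide (no _) = ≤-trans (≤-reflexive (ℚP.*-zeroˡ (π y))) (0≤sum {suc D} (λ j → 0≤ov (toℕ j) y))
  πA≤ : sumℚ (λ y → A y * π y) ≤ fromℕ (suc D) * ε
  πA≤ = begin
    sumℚ (λ y → A y * π y)                                          ≤⟨ sum-mono on-A ⟩
    sumℚ (λ y → sumℚ {suc D} (λ j → common (u (toℕ j) y) (π y)))   ≡⟨ sum-swap (λ y (j : Fin (suc D)) → common (u (toℕ j) y) (π y)) ⟩
    sumℚ {suc D} (λ j → sumℚ (λ y → common (u (toℕ j) y) (π y)))   ≤⟨ sum-mono {suc D} (λ j → common≤ε (toℕ j) (FinP.toℕ≤pred[n] j)) ⟩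
    sumℚ {suc D} (λ _ → ε)                                          ≡⟨ sum-const (suc D) ε ⟩
    fromℕ (suc D) * ε                                               ∎
    where open ℚP.≤-Reasoning
  1-g : ∀ i → 1ℚ - g i ≡ sumℚ (λ y → (1ℚ - A y) * u i y)
  1-g i = trans (cong (_- g i) (sym (proj₂ (u-prob i))))
    (trans (sym (sum-- (u i) (λ y → A y * u i y))) (sum-cong (λ y → lemma (A y) (u i y))))
    where
    lemma : ∀ a b → b - a * b ≡ (1ℚ - a) * b
    lemma = solve-∀ ring
  D+3 : fromℕ (D ℕ.+ 3) ≡ fromℕ (suc D) + (1ℚ + 1ℚ)
  D+3 = trans (cong fromℕ (ℕP.+-suc D 2)) (fromℕ-+ (suc D) 2)
  ε≤η : ε ≤ η
  ε≤η = subst (_≤ η) (ℚP.*-identityˡ ε) (*-monoʳ-≤ 0≤ε (fromℕ-mono-≤ {1} (ℕP.≤-trans (ℕ.s≤s ℕ.z≤n) (ℕP.m≤n+m 3 D))))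
  g-early : ∀ i → i ℕ.≤ D → ∣ g i - 1ℚ ∣ ≤ η
  g-early i i≤D = subst (_≤ η) (sym (trans (∣p-q∣≡∣q-p∣ (g i) 1ℚ) (ℚP.0≤p⇒∣p∣≡p (p≤q⇒0≤q-p (g≤1 i)))))
    (subst (_≤ η) (sym (1-g i)) (≤-trans (sum-mono (off-A i i≤D)) (≤-trans (common≤ε i i≤D) ε≤η)))
  g-late : ∀ i → D ℕ.< i → ∣ g i ∣ ≤ η
  g-late i D<i = subst (_≤ η) (sym (ℚP.0≤p⇒∣p∣≡p (0≤g i))) (begin
    g i
      ≡⟨ sum-cong (λ y → split (A y) (u i y) (π y)) ⟩
    sumℚ (λ y → A y * (u i y - π y) + A y * π y)
      ≡⟨ sum-+ (λ y → A y * (u i y - π y)) (λ y → A y * π y) ⟩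
    sumℚ (λ y → A y * (u i y - π y)) + sumℚ (λ y → A y * π y)
      ≤⟨ +-mono-≤ (sum-mono pointwise) πA≤ ⟩
    norm (λ y → u i y - π y) + fromℕ (suc D) * ε
      ≡⟨ halve (norm (λ y → u i y - π y)) (fromℕ (suc D) * ε) ⟩
    (1ℚ + 1ℚ) * tv (u i) π + fromℕ (suc D) * ε
      ≤⟨ ℚP.+-monoˡ-≤ (fromℕ (suc D) * ε) (*-monoˡ-≤ {1ℚ + 1ℚ} (ℚP.nonNegative⁻¹ (1ℚ + 1ℚ)) (late i D<i)) ⟩
    (1ℚ + 1ℚ) * ε + fromℕ (suc D) * ε
      ≡⟨ collect ε (fromℕ (suc D)) ⟩
    (fromℕ (suc D) + (1ℚ + 1ℚ)) * ε
      ≡⟨ cong (_* ε) D+3 ⟨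
    η ∎)
    where
    open ℚP.≤-Reasoning
    split : ∀ a b c → a * b ≡ a * (b - c) + a * c
    split = solve-∀ ring
    halve : ∀ a b → a + b ≡ (1ℚ + 1ℚ) * (½ * a) + b
    halve = solve-∀ ring
    collect : ∀ e d → (1ℚ + 1ℚ) * e + d * e ≡ (d + (1ℚ + 1ℚ)) * e
    collect = solve-∀ ring
    pointwise : ∀ y → A y * (u i y - π y) ≤ ∣ u i y - π y ∣
    pointwise y = ≤-trans (*-monoˡ-≤ (0≤A y) (p≤∣p∣ (u i y - π y)))
      (subst (A y * ∣ u i y - π y ∣ ≤_) (ℚP.*-identityˡ ∣ u i y - π y ∣) (*-monoʳ-≤ (0≤∣p∣ (u i y - π y)) (A≤1 y)))
  -- The mass given to `A` is a linear functional, so it inherits the relation between the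
  -- distributions.
  g-recurrence : ∀ s → sumℚ (λ j → c j * g (toℕ j ℕ.+ s)) ≡ 0ℚ
  g-recurrence s = begin
    sumℚ (λ j → c j * sumℚ (λ y → A y * u (toℕ j ℕ.+ s) y))
      ≡⟨ sum-cong (λ j → *-sum (c j) (λ y → A y * u (toℕ j ℕ.+ s) y)) ⟩
    sumℚ (λ j → sumℚ (λ y → c j * (A y * u (toℕ j ℕ.+ s) y)))
      ≡⟨ sum-swap (λ j y → c j * (A y * u (toℕ j ℕ.+ s) y)) ⟩
    sumℚ (λ y → sumℚ (λ j → c j * (A y * u (toℕ j ℕ.+ s) y)))
      ≡⟨ sum-cong (λ y → trans (sum-cong (λ j → swap (c j) (A y) (u (toℕ j ℕ.+ s) y)))
           (sym (*-sum (A y) (λ j → c j * u (toℕ j ℕ.+ s) y)))) ⟩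
    sumℚ (λ y → A y * sumℚ (λ j → c j * u (toℕ j ℕ.+ s) y))
      ≡⟨ sum-zero _ (λ y → trans (cong (A y *_) (recurrence s y)) (ℚP.*-zeroʳ (A y))) ⟩
    0ℚ ∎
    where
    open ≡-Reasoning
    swap : ∀ a b c → a * (b * c) ≡ b * (a * c)
    swap = solve-∀ ring

-- Sums of natural numbers

sumℕ≡sum : ∀ {k} (f : Fin k → ℕ) → sumℕ f ≡ CMℕ.sum f
sumℕ≡sum {zero} f = refl
sumℕ≡sum {suc k} f = cong (f zero ℕ.+_) (sumℕ≡sum (f ∘ suc))

sumℕ-cong : ∀ {k} {f g : Fin k → ℕ} → (∀ i → f i ≡ g i) → sumℕ f ≡ sumℕ g
sumℕ-cong {zero} e = refl
sumℕ-cong {suc k} e = cong₂ ℕ._+_ (e zero) (sumℕ-cong (e ∘ suc))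

sumℕ-permute : ∀ {k} (f : Fin k → ℕ) (ρ : Permutation′ k) → sumℕ f ≡ sumℕ (λ i → f (ρ ⟨$⟩ʳ i))
sumℕ-permute f ρ = trans (sumℕ≡sum f) (trans (CMℕ.sum-permute f ρ) (sym (sumℕ≡sum (λ i → f (ρ ⟨$⟩ʳ i)))))

fromℕ-sum : ∀ {k} (f : Fin k → ℕ) → fromℕ (sumℕ f) ≡ sumℚ (λ i → fromℕ (f i))
fromℕ-sum {zero} f = refl
fromℕ-sum {suc k} f = trans (fromℕ-+ (f zero) (sumℕ (f ∘ suc))) (cong (fromℕ (f zero) +_) (fromℕ-sum (f ∘ suc)))

⇔true⇒≡ : ∀ {a b} → (a ≡ true → b ≡ true) → (b ≡ true → a ≡ true) → a ≡ b
⇔true⇒≡ {true}  {b}     f g = sym (f refl)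
⇔true⇒≡ {false} {true}  f g = g refl
⇔true⇒≡ {false} {false} f g = refl

-- Simple random walks and their symmetries

module Walk (G : FIGraph) (n : ℕ) where
  open FIGraph G
  open SRW G n
  open FISetProperties V

  Automorphism : Permutation′ (card n) → Set
  Automorphism ρ = ∀ x y → adj n (ρ ⟨$⟩ʳ x) (ρ ⟨$⟩ʳ y) ≡ adj n x y

  -- Functoriality only says that edges are preserved; applying it to the inverse permutation shows
  -- that they are also reflected.
  actPermutation-automorphism : ∀ ρ → Automorphism (actPermutation ρ)
  actPermutation-automorphism ρ x y = ⇔true⇒≡
    (λ e → trans (sym (cong₂ (adj n) (Perm.inverseˡ (actPermutation ρ)) (Perm.inverseˡ (actPermutation ρ))))
             (adj-hom (↔⇒↣ (flip ρ)) _ _ e))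
    (adj-hom (↔⇒↣ ρ) x y)

  deg-automorphism : ∀ ρ → Automorphism ρ → ∀ x → deg (ρ ⟨$⟩ʳ x) ≡ deg x
  deg-automorphism ρ aut x = trans
    (sumℕ-permute (λ z → if adj n (ρ ⟨$⟩ʳ x) z then 1 else 0) ρ)
    (sumℕ-cong (λ z → cong (λ b → if b then 1 else 0) (aut x z)))

  P-automorphism : ∀ ρ → Automorphism ρ → ∀ x y → P (ρ ⟨$⟩ʳ x) (ρ ⟨$⟩ʳ y) ≡ P x y
  P-automorphism ρ aut x y =
    cong₂ (λ b d → if b then inv d else 0ℚ) (aut x y) (deg-automorphism ρ aut x)

  Pt-zero : ∀ x y → Pt 0 x y ≡ δ x y
  Pt-zero x y with x ≟ y
  ... | yes _ = refl
  ... | no _ = refl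

  Pt-refl : ∀ x → Pt 0 x x ≡ 1ℚ
  Pt-refl x with x ≟ x
  ... | yes _ = refl
  ... | no x≢x = contradiction refl x≢x

  Pt-automorphism : ∀ ρ → Automorphism ρ → ∀ t x y → Pt t (ρ ⟨$⟩ʳ x) (ρ ⟨$⟩ʳ y) ≡ Pt t x y
  Pt-automorphism ρ aut zero x y with (ρ ⟨$⟩ʳ x) ≟ (ρ ⟨$⟩ʳ y) | x ≟ y
  ... | yes _  | yes _  = refl
  ... | yes e  | no x≢y = contradiction
    (trans (sym (Perm.inverseˡ ρ)) (trans (cong (ρ ⟨$⟩ˡ_) e) (Perm.inverseˡ ρ))) x≢y
  ... | no ne  | yes e  = contradiction (cong (ρ ⟨$⟩ʳ_) e) ne
  ... | no _   | no _   = refl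
  Pt-automorphism ρ aut (suc t) x y = trans
    (sum-permute (λ z → Pt t (ρ ⟨$⟩ʳ x) z * P z (ρ ⟨$⟩ʳ y)) ρ)
    (sum-cong (λ z → cong₂ _*_ (Pt-automorphism ρ aut t x z) (P-automorphism ρ aut z y)))

  -- The Chapman-Kolmogorov equation.
  Pt-+ : ∀ s t x y → Pt (s ℕ.+ t) x y ≡ (Pt s x ⊛ Pt t) y
  Pt-+ s zero x y = trans (cong (λ r → Pt r x y) (ℕP.+-identityʳ s))
    (sym (trans (sum-cong (λ z → trans (ℚP.*-comm (Pt s x z) (Pt 0 z y)) (cong (_* Pt s x z) (sym-δ z))))
      (sum-δ y (Pt s x))))
    where
    sym-δ : ∀ z → Pt 0 z y ≡ δ y z
    sym-δ z with z ≟ y | y ≟ z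
    ... | yes _ | yes _ = refl
    ... | yes e | no ne = contradiction (sym e) ne
    ... | no ne | yes e = contradiction (sym e) ne
    ... | no _  | no _  = refl
  Pt-+ s (suc t) x y = begin
    Pt (s ℕ.+ suc t) x y                  ≡⟨ cong (λ r → Pt r x y) (ℕP.+-suc s t) ⟩
    (Pt (s ℕ.+ t) x ⊛ P) y                ≡⟨ sum-cong (λ z → cong (_* P z y) (Pt-+ s t x z)) ⟩
    ((Pt s x ⊛ Pt t) ⊛ P) y               ≡⟨ ⊛-assoc (Pt s x) (Pt t) P y ⟩
    (Pt s x ⊛ Pt (suc t)) y               ∎
    where open ≡-Reasoning

  module Regular (k : ℕ) (deg≡ : ∀ y → deg y ≡ suc k) where

    0≤P : ∀ x y → 0ℚ ≤ P x y
    0≤P x y with adj n x y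
    ... | true = 0≤inv (deg x)
    ... | false = ≤-refl

    0<P : ∀ x y → adj n x y ≡ true → 0ℚ < P x y
    0<P x y e = subst₂ (λ b d → 0ℚ < (if b then inv d else 0ℚ)) (sym e) (sym (deg≡ x)) (0<inv k)

    -- Equal degrees make the transition matrix symmetric. Hence its columns also sum to 1, and the
    -- uniform distribution is stationary.
    P-sym : ∀ x y → P x y ≡ P y x
    P-sym x y = cong₂ (λ b d → if b then inv d else 0ℚ) (adj-sym n x y) (trans (deg≡ x) (sym (deg≡ y)))

    P-row : ∀ x → sumℚ (P x) ≡ 1ℚ
    P-row x = begin
      sumℚ (P x)
        ≡⟨ sum-cong (λ y → entry (adj n x y)) ⟩
      sumℚ (λ y → fromℕ (if adj n x y then 1 else 0) * inv (deg x))
        ≡⟨ sum-* (λ y → fromℕ (if adj n x y then 1 else 0)) (inv (deg x)) ⟨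
      sumℚ (λ y → fromℕ (if adj n x y then 1 else 0)) * inv (deg x)
        ≡⟨ cong (_* inv (deg x)) (fromℕ-sum (λ y → if adj n x y then 1 else 0)) ⟨
      fromℕ (deg x) * inv (deg x)
        ≡⟨ cong (λ d → fromℕ d * inv d) (deg≡ x) ⟩
      fromℕ (suc k) * inv (suc k)
        ≡⟨ fromℕ*inv k ⟩
      1ℚ ∎
      where
      open ≡-Reasoning
      entry : ∀ b → (if b then inv (deg x) else 0ℚ) ≡ fromℕ (if b then 1 else 0) * inv (deg x)
      entry true = sym (ℚP.*-identityˡ (inv (deg x)))
      entry false = sym (ℚP.*-zeroˡ (inv (deg x)))

    Pt-one : ∀ x y → Pt 1 x y ≡ P x y
    Pt-one x y = trans (sum-cong (λ z → cong (_* P z y) (Pt-zero x z))) (sum-δ x (λ z → P z y))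

    0≤Pt : ∀ t x y → 0ℚ ≤ Pt t x y
    0≤Pt zero x y with x ≟ y
    ... | yes _ = ℚP.nonNegative⁻¹ 1ℚ
    ... | no _ = ≤-refl
    0≤Pt (suc t) x y = 0≤sum (λ z → 0≤* (0≤Pt t x z) (0≤P z y))

    Pt-row : ∀ t x → sumℚ (Pt t x) ≡ 1ℚ
    Pt-row zero x = trans (sum-cong (Pt-zero x)) (sum-δ-row x)
    Pt-row (suc t) x = trans (sum-⊛ (Pt t x) P 1ℚ P-row)
      (trans (ℚP.*-identityʳ (sumℚ (Pt t x))) (Pt-row t x))

    Pt-probability : ∀ t x → IsProbability (Pt t x)
    Pt-probability t x = 0≤Pt t x , Pt-row t x

    -- Reversing the walk turns its last step into a first one, which `Pt-+` splits off.
    Pt-sym : ∀ t x y → Pt t x y ≡ Pt t y x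
    Pt-sym zero x y with x ≟ y | y ≟ x
    ... | yes _ | yes _ = refl
    ... | yes e | no ne = contradiction (sym e) ne
    ... | no ne | yes e = contradiction (sym e) ne
    ... | no _  | no _  = refl
    Pt-sym (suc t) x y = begin
      sumℚ (λ z → Pt t x z * P z y)      ≡⟨ sum-cong (λ z → trans (ℚP.*-comm (Pt t x z) (P z y))
                                              (cong₂ _*_ (trans (P-sym z y) (sym (Pt-one y z))) (Pt-sym t x z))) ⟩
      sumℚ (λ z → Pt 1 y z * Pt t z x)   ≡⟨ Pt-+ 1 t y x ⟨
      Pt (suc t) y x                     ∎
      where open ≡-Reasoning

    Pt-column : ∀ t y → sumℚ (λ x → Pt t x y) ≡ 1ℚ
    Pt-column t y = trans (sum-cong (λ x → Pt-sym t x y)) (Pt-row t y)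

    uniform : Vx → ℚ
    uniform _ = inv (card n)

    -- The vertex argument excludes `card n = 0`, where the default `inv 0 = 0ℚ` would give mass 0.
    card≢0⇒uniform-mass : Vx → sumℚ uniform ≡ 1ℚ
    card≢0⇒uniform-mass x = trans (sum-const (card n) (inv (card n))) (lemma x)
      where
      lemma : ∀ {m} → Fin m → fromℕ m * inv m ≡ 1ℚ
      lemma {suc m} _ = fromℕ*inv m

    uniform-probability : Vx → IsProbability uniform
    uniform-probability x = (λ _ → 0≤inv (card n)) , card≢0⇒uniform-mass x

    uniform-⊛ : ∀ t y → (uniform ⊛ Pt t) y ≡ uniform y
    uniform-⊛ t y = trans (sym (*-sum (inv (card n)) (λ x → Pt t x y)))
      (trans (cong (inv (card n) *_) (Pt-column t y)) (ℚP.*-identityʳ (inv (card n))))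

    uniform-stationary : Vx → IsStationary uniform
    uniform-stationary x = (λ _ → 0≤inv (card n)) , card≢0⇒uniform-mass x ,
      λ z → trans (sum-cong (λ y → cong (inv (card n) *_) (sym (Pt-one y z)))) (uniform-⊛ 1 z)

    deviation : ℕ → Vx → Vx → ℚ
    deviation t x y = Pt t x y - uniform y

    deviation-mass : ∀ t x → sumℚ (deviation t x) ≡ 0ℚ
    deviation-mass t x = trans (sum-- (Pt t x) uniform)
      (cong₂ _-_ (Pt-row t x) (card≢0⇒uniform-mass x))

    deviation-+ : ∀ s t x y → deviation (s ℕ.+ t) x y ≡ (deviation s x ⊛ Pt t) y
    deviation-+ s t x y = trans (cong₂ _-_ (Pt-+ s t x y) (sym (uniform-⊛ t y)))
      (sym (⊛-linear (Pt s x) uniform (Pt t) y))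

    -- Deviations from the uniform distribution evolve under the same kernel, which has row sums 1
    -- and so does not increase the norm.
    TV-antitone : ∀ {s t} → s ℕ.≤ t → ∀ x → TV uniform t x ≤ TV uniform s x
    TV-antitone {s} {t} s≤t x = *-monoˡ-≤ (ℚP.nonNegative⁻¹ ½) (subst₂ _≤_
      (trans (sym (norm-cong (deviation-+ s (t ℕ.∸ s) x))) (cong (λ r → norm (deviation r x)) (ℕP.m+[n∸m]≡n s≤t)))
      (ℚP.*-identityʳ (norm (deviation s x)))
      (norm-⊛ (deviation s x) (Pt (t ℕ.∸ s)) 1ℚ (0≤Pt (t ℕ.∸ s)) (Pt-row (t ℕ.∸ s))))

    0<Pt-+ : ∀ s t x y z → 0ℚ < Pt s x y → 0ℚ < Pt t y z → 0ℚ < Pt (s ℕ.+ t) x z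
    0<Pt-+ s t x y z p q = subst (0ℚ <_) (sym (Pt-+ s t x z))
      (ℚP.<-≤-trans (0<* p q) (term≤sum (λ w → 0≤* (0≤Pt s x w) (0≤Pt t w z)) y))

    Reach⇒0<Pt : ∀ {x y} → Reach G n x y → ∃[ t ] 0ℚ < Pt t x y
    Reach⇒0<Pt {x} here = 0 , subst (0ℚ <_) (sym (Pt-refl x)) (ℚP.positive⁻¹ 1ℚ)
    Reach⇒0<Pt {x} (step {y = w} e r) with Reach⇒0<Pt r
    ... | t , p = suc t , 0<Pt-+ 1 t x w _ (subst (0ℚ <_) (sym (Pt-one x w)) (0<P x w e)) p

    neighbour : ∀ x → ∃[ y ] adj n x y ≡ true
    neighbour x = find (λ y → adj n x y) (subst (0 ℕ.<_) (sym (deg≡ x)) (ℕ.s≤s ℕ.z≤n))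
      where
      find : ∀ {m} (b : Fin m → Bool) → 0 ℕ.< sumℕ (λ z → if b z then 1 else 0) → ∃[ y ] b y ≡ true
      find {suc m} b pos with b zero in eq
      ... | true = zero , eq
      ... | false with find (b ∘ suc) pos
      ...   | y , e = suc y , e

    0<Pt-even : ∀ i x → 0ℚ < Pt (i ℕ.+ i) x x
    0<Pt-even zero x = subst (0ℚ <_) (sym (Pt-refl x)) (ℚP.positive⁻¹ 1ℚ)
    0<Pt-even (suc i) x with neighbour x
    ... | y , e = subst (λ t → 0ℚ < Pt (suc t) x x) (sym (ℕP.+-suc i i))
      (0<Pt-+ 2 (i ℕ.+ i) x x x
        (0<Pt-+ 1 1 x y x
          (subst (0ℚ <_) (sym (Pt-one x y)) (0<P x y e))
          (subst (0ℚ <_) (sym (Pt-one y x)) (0<P y x (trans (adj-sym n y x) e))))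
        (0<Pt-even i x))

    -- A common time is obtained by padding with steps back and forth along an edge.
    minorization : ∀ x → (∀ z → ∃[ ℓ ] 0ℚ < Pt (ℓ ℕ.+ ℓ) z x) →
                   ∃[ T ] ∃[ α ] (0ℚ < α × (∀ z → α ≤ Pt T z x))
    minorization x even = T , positive-lower-bound (λ z → Pt T z x) 0<PT
      where
      bound = upper-bound (λ z → proj₁ (even z))
      L = proj₁ bound
      T = L ℕ.+ L
      0<PT : ∀ z → 0ℚ < Pt T z x
      0<PT z = subst (λ t → 0ℚ < Pt t z x) lengths
        (0<Pt-+ (i ℕ.+ i) (ℓ ℕ.+ ℓ) z z x (0<Pt-even i z) (proj₂ (even z)))
        where
        ℓ = proj₁ (even z)
        i = L ℕ.∸ ℓ
        lengths : (i ℕ.+ i) ℕ.+ (ℓ ℕ.+ ℓ) ≡ L ℕ.+ L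
        lengths = trans (interchange i i ℓ ℓ) (cong₂ ℕ._+_ i+ℓ i+ℓ)
          where
          open CommutativeSemigroup ℕP.+-commutativeSemigroup using (interchange)
          i+ℓ : i ℕ.+ ℓ ≡ L
          i+ℓ = ℕP.m∸n+n≡m (proj₂ bound z)

    module Minorized (x₀ : Vx) (T : ℕ) (α : ℚ) (0<α : 0ℚ < α) (minor : ∀ z → α ≤ Pt T z x₀) where

      contraction : ∀ (w : Vx → ℚ) → sumℚ w ≡ 0ℚ → norm (w ⊛ Pt T) ≤ norm w * (1ℚ - α)
      contraction w = doeblin w (Pt T) x₀ α (0≤Pt T) (Pt-row T) minor

      -- Along multiples of `T` the deviation has mass zero, so each block of `T` steps shrinks its
      -- norm by the factor `1 - α`.
      eventually-close : ∀ x ε → 0ℚ < ε → ∃[ t ] TV uniform t x ≤ ε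
      eventually-close x ε 0<ε = close (contracting-sequence a α 0<α contract ε 0<ε)
        where
        a : ℕ → ℚ
        a j = norm (deviation (j ℕ.* T) x)
        contract : ∀ j → a (suc j) ≤ a j * (1ℚ - α)
        contract j = subst (_≤ a j * (1ℚ - α))
          (trans (sym (norm-cong (deviation-+ (j ℕ.* T) T x)))
            (cong (λ r → norm (deviation r x)) (ℕP.+-comm (j ℕ.* T) T)))
          (contraction (deviation (j ℕ.* T) x) (deviation-mass (j ℕ.* T) x))
        close : ∃[ j ] a j ≤ ε → ∃[ t ] TV uniform t x ≤ ε
        close (j , aj≤ε) = j ℕ.* T , ≤-trans
          (≤-by (½ * a j) (0≤* (ℚP.nonNegative⁻¹ ½) (0≤norm (deviation (j ℕ.* T) x))) (half (a j))) aj≤ε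
          where
          half : ∀ b → b - ½ * b ≡ ½ * b
          half = solve-∀ ring

      -- The difference `w` of two stationary distributions has mass zero and is fixed by `Pt T`,
      -- which also contracts its norm by `1 - α`; hence the norm is zero. `MixedBy` quantifies over
      -- all stationary `π`, and this reduces it to `uniform`.
      stationary-unique : ∀ π → IsStationary π → ∀ y → π y ≡ uniform y
      stationary-unique π (_ , mass , invariant) y = difference-zero (π y) (uniform y)
        (ℚP.∣p∣≡0⇒p≡0 (w y) (ℚP.≤-antisym (≤-trans (term≤sum (λ z → 0≤∣p∣ (w z)) y) norm≤0) (0≤∣p∣ (w y))))
        where
        w : Vx → ℚ
        w y = π y - uniform y
        difference-zero : ∀ p q → p - q ≡ 0ℚ → p ≡ q
        difference-zero p q e = trans (split p q) (trans (cong (_+ q) e) (ℚP.+-identityˡ q))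
          where
          split : ∀ p q → p ≡ (p - q) + q
          split = solve-∀ ring
        π-⊛ : ∀ t y → (π ⊛ Pt t) y ≡ π y
        π-⊛ zero y = trans (sum-cong (λ z → trans (cong (π z *_) (trans (Pt-sym 0 z y) (Pt-zero y z)))
          (ℚP.*-comm (π z) (δ y z)))) (sum-δ y π)
        π-⊛ (suc t) y = trans (sym (⊛-assoc π (Pt t) P y))
          (trans (sum-cong (λ z → cong (_* P z y) (π-⊛ t z))) (invariant y))
        w-⊛ : ∀ y → (w ⊛ Pt T) y ≡ w y
        w-⊛ y = trans (⊛-linear π uniform (Pt T) y) (cong₂ _-_ (π-⊛ T y) (uniform-⊛ T y))
        w-mass : sumℚ w ≡ 0ℚ
        w-mass = trans (sum-- π uniform) (cong₂ _-_ mass (card≢0⇒uniform-mass y))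
        contracted : norm w ≤ norm w * (1ℚ - α)
        contracted = subst (_≤ norm w * (1ℚ - α)) (norm-cong w-⊛) (contraction w w-mass)
        norm≤0 : norm w ≤ 0ℚ
        norm≤0 = ℚP.*-cancelˡ-≤-pos α {{ℚ.positive 0<α}}
          (≤-by _ (p≤q⇒0≤q-p contracted) (loss α (norm w)))
          where
          loss : ∀ a b → a * 0ℚ - a * b ≡ b * (1ℚ - a) - b
          loss = solve-∀ ring

-- Choice of accuracy and time scale

0<⊓ : ∀ {p q} → 0ℚ < p → 0ℚ < q → 0ℚ < p ℚ.⊓ q
0<⊓ {p} {q} 0<p 0<q with ℚP.⊓-sel p q
... | inj₁ e = subst (0ℚ <_) (sym e) 0<p
... | inj₂ e = subst (0ℚ <_) (sym e) 0<q

least : ∀ {P : ℕ → Set} → (∀ m → Dec (P m)) → ∀ n → P n → ∃[ m ] (P m × (∀ s → P s → m ℕ.≤ s))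
least P? n p with P? 0
... | yes p₀ = 0 , p₀ , λ _ _ → ℕ.z≤n
least P? zero p | no ¬p₀ = contradiction p ¬p₀
least P? (suc n) p | no ¬p₀ with least (λ m → P? (suc m)) n p
... | m , pm , min = suc m , pm , λ where
  zero    p₀ → contradiction p₀ ¬p₀
  (suc s) ps → ℕ.s≤s (min s ps)

-- Clears the denominator in `t ≤ s + s / (K + 1)`.
ratio-bound : ∀ K t s → ∣ fromℕ t - fromℕ s ∣ ≤ inv (suc K) * fromℕ s →
              suc K ℕ.* t ℕ.≤ suc K ℕ.* s ℕ.+ s
ratio-bound K t s close = fromℕ-cancel-≤ (begin
  fromℕ (suc K ℕ.* t)                                     ≡⟨ fromℕ-* (suc K) t ⟩
  fromℕ (suc K) * fromℕ t                                 ≡⟨ split (fromℕ (suc K)) (fromℕ t) (fromℕ s) ⟩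
  fromℕ (suc K) * fromℕ s + fromℕ (suc K) * (fromℕ t - fromℕ s)
    ≤⟨ ℚP.+-monoʳ-≤ (fromℕ (suc K) * fromℕ s) (*-monoˡ-≤ (0≤fromℕ (suc K)) (≤-trans (p≤∣p∣ (fromℕ t - fromℕ s)) close)) ⟩
  fromℕ (suc K) * fromℕ s + fromℕ (suc K) * (inv (suc K) * fromℕ s)
    ≡⟨ cong (_+_ (fromℕ (suc K) * fromℕ s)) (trans (sym (ℚP.*-assoc (fromℕ (suc K)) (inv (suc K)) (fromℕ s)))
         (trans (cong (_* fromℕ s) (fromℕ*inv K)) (ℚP.*-identityˡ (fromℕ s)))) ⟩
  fromℕ (suc K) * fromℕ s + fromℕ s                       ≡⟨ cong (_+ fromℕ s) (fromℕ-* (suc K) s) ⟨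
  fromℕ (suc K ℕ.* s) + fromℕ s                           ≡⟨ fromℕ-+ (suc K ℕ.* s) s ⟨
  fromℕ (suc K ℕ.* s ℕ.+ s)                               ∎)
  where
  open ℚP.≤-Reasoning
  split : ∀ k t s → k * t ≡ k * s + k * (t - s)
  split = solve-∀ ring

-- If t / s ≤ 1 + 1 / 2R with R = 2D + 1, then k = 2 ⌊s / R⌋ separates
-- the multiples 0, …, D k < s from those beyond t ≤ (D + 1) k.
time-scale : ∀ D t s → let R = suc (D ℕ.+ D) in
             (R ℕ.+ R) ℕ.* t ℕ.≤ (R ℕ.+ R) ℕ.* s ℕ.+ s →
             2 ℕ.* (suc (R ℕ.+ R) ℕ.* R) ℕ.< t →
             ∃[ k ] (D ℕ.* k ℕ.< s × t ℕ.≤ suc D ℕ.* k)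
time-scale D t s close large = q ℕ.+ q , below , above
  where
  open ℕP.≤-Reasoning
  R = suc (D ℕ.+ D)
  q = s DivMod./ R
  r = s DivMod.% R
  s≡ : s ≡ r ℕ.+ q ℕ.* R
  s≡ = DivMod.m≡m%n+[m/n]*n s R
  t≤2s : t ℕ.≤ 2 ℕ.* s
  t≤2s = ℕP.*-cancelˡ-≤ (R ℕ.+ R) (begin
    (R ℕ.+ R) ℕ.* t               ≤⟨ close ⟩
    (R ℕ.+ R) ℕ.* s ℕ.+ s         ≤⟨ ℕP.+-monoʳ-≤ ((R ℕ.+ R) ℕ.* s) (ℕP.m≤n*m s (R ℕ.+ R)) ⟩
    (R ℕ.+ R) ℕ.* s ℕ.+ (R ℕ.+ R) ℕ.* s  ≡⟨ double (R ℕ.+ R) s ⟩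
    (R ℕ.+ R) ℕ.* (2 ℕ.* s)       ∎)
    where
    double : ∀ a b → a ℕ.* b ℕ.+ a ℕ.* b ≡ a ℕ.* (2 ℕ.* b)
    double = solveℕ-∀
  -- The lower bound on `t` passes to `s` through `t ≤ 2 s`, and then to the quotient by `R`.
  q-large : suc (R ℕ.+ R) ℕ.≤ q
  q-large = subst (ℕ._≤ q) (DivMod.m*n/n≡m (suc (R ℕ.+ R)) R)
    (DivMod./-monoˡ-≤ R (ℕP.*-cancelˡ-≤ {suc (R ℕ.+ R) ℕ.* R} {s} 2 (ℕP.≤-trans (ℕP.<⇒≤ large) t≤2s)))
  below : D ℕ.* (q ℕ.+ q) ℕ.< s
  below = begin-strict
    D ℕ.* (q ℕ.+ q)            <⟨ ℕP.m<m+n (D ℕ.* (q ℕ.+ q)) (ℕP.≤-trans (ℕ.s≤s ℕ.z≤n) q-large) ⟩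
    D ℕ.* (q ℕ.+ q) ℕ.+ q      ≡⟨ expand D q ⟩
    q ℕ.* R                    ≤⟨ ℕP.m≤n+m (q ℕ.* R) r ⟩
    r ℕ.+ q ℕ.* R              ≡⟨ s≡ ⟨
    s                          ∎
    where
    expand : ∀ D q → D ℕ.* (q ℕ.+ q) ℕ.+ q ≡ q ℕ.* suc (D ℕ.+ D)
    expand = solveℕ-∀
  s≤ : s ℕ.≤ R ℕ.+ q ℕ.* R
  s≤ = subst (ℕ._≤ R ℕ.+ q ℕ.* R) (sym s≡) (ℕP.+-monoˡ-≤ (q ℕ.* R) (ℕP.<⇒≤ (DivMod.m%n<n s R)))
  -- Here `s` is replaced by its upper bound `R + q R`; the rounding error, a multiple `2 R + 1` of
  -- `R`, is absorbed into `q R` by `q-large`.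
  above : t ℕ.≤ suc D ℕ.* (q ℕ.+ q)
  above = ℕP.*-cancelˡ-≤ (R ℕ.+ R) (begin
    (R ℕ.+ R) ℕ.* t                                      ≤⟨ close ⟩
    (R ℕ.+ R) ℕ.* s ℕ.+ s                                ≤⟨ ℕP.+-mono-≤ (ℕP.*-monoʳ-≤ (R ℕ.+ R) s≤) s≤ ⟩
    (R ℕ.+ R) ℕ.* (R ℕ.+ q ℕ.* R) ℕ.+ (R ℕ.+ q ℕ.* R)    ≡⟨ expand₁ R q ⟩
    R ℕ.* (suc (R ℕ.+ R) ℕ.+ (q ℕ.+ 2 ℕ.* (q ℕ.* R)))
      ≤⟨ ℕP.*-monoʳ-≤ R (ℕP.+-monoˡ-≤ (q ℕ.+ 2 ℕ.* (q ℕ.* R)) q-large) ⟩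
    R ℕ.* (q ℕ.+ (q ℕ.+ 2 ℕ.* (q ℕ.* R)))                ≡⟨ expand₂ D q ⟩
    (R ℕ.+ R) ℕ.* (suc D ℕ.* (q ℕ.+ q))                  ∎)
    where
    expand₁ : ∀ R q → (R ℕ.+ R) ℕ.* (R ℕ.+ q ℕ.* R) ℕ.+ (R ℕ.+ q ℕ.* R) ≡
                      R ℕ.* (suc (R ℕ.+ R) ℕ.+ (q ℕ.+ 2 ℕ.* (q ℕ.* R)))
    expand₁ = solveℕ-∀
    expand₂ : ∀ D q → let R = suc (D ℕ.+ D) in
              R ℕ.* (q ℕ.+ (q ℕ.+ 2 ℕ.* (q ℕ.* R))) ≡ (R ℕ.+ R) ℕ.* (suc D ℕ.* (q ℕ.+ q))
    expand₂ = solveℕ-∀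

small-multiple : ∀ a b ε → ε ≤ inv (suc (a ℕ.* (b ℕ.+ b))) →
                 fromℕ a * (fromℕ b * ε + fromℕ b * ε) < 1ℚ
small-multiple a b ε ε≤ = begin-strict
  fromℕ a * (fromℕ b * ε + fromℕ b * ε)   ≡⟨ collect (fromℕ a) (fromℕ b) ε ⟩
  fromℕ a * (fromℕ b + fromℕ b) * ε       ≡⟨ cong (_* ε) (trans (cong (fromℕ a *_) (sym (fromℕ-+ b b))) (sym (fromℕ-* a (b ℕ.+ b)))) ⟩
  fromℕ M * ε                             ≤⟨ *-monoˡ-≤ (0≤fromℕ M) ε≤ ⟩
  fromℕ M * inv (suc M)                   <⟨ ℚP.*-monoˡ-<-pos (inv (suc M)) {{ℚ.positive (0<inv M)}} (fromℕ-mono-< (ℕP.n<1+n M)) ⟩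
  fromℕ (suc M) * inv (suc M)             ≡⟨ fromℕ*inv M ⟩
  1ℚ                                      ∎
  where
  open ℚP.≤-Reasoning
  M = a ℕ.* (b ℕ.+ b)
  collect : ∀ a b e → a * (b * e + b * e) ≡ a * (b + b) * e
  collect = solve-∀ ring

-- Walks on a transitive FI-graph in one large degree

module TransitiveWalk (G : FIGraph) (connected : Connected G) {d} (gen : GeneratedInDegree (FIGraph.V G) d)
  (n : ℕ) (3d≤n : d ℕ.+ (d ℕ.+ d) ℕ.≤ n)
  (transitive : ∀ x y → ∃[ σ ] (FIGraph.act G {n} {n} σ x ≡ y)) where

  open FIGraph G
  open SRW G n
  open FISetProperties V
  open Walk G n

  private
    d≤n : d ℕ.≤′ n
    d≤n = ℕP.≤⇒≤′ (ℕP.≤-trans (ℕP.m≤m+n d (d ℕ.+ d)) 3d≤n)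

    D : ℕ
    D = orbitalBound gen

  automorphism-to : ∀ x y → ∃[ ρ ] (Automorphism ρ × ρ ⟨$⟩ʳ x ≡ y)
  automorphism-to x y =
    let σ , σx≡y = transitive x y
        ρ , ρ≗σ = act-permutation σ
    in actPermutation ρ , actPermutation-automorphism ρ , trans (ρ≗σ x) σx≡y

  deg-constant : ∀ x y → deg y ≡ deg x
  deg-constant x y =
    let ρ , aut , ρx≡y = automorphism-to x y
    in trans (cong deg (sym ρx≡y)) (deg-automorphism ρ aut x)

  -- The conjugating permutation acts by an automorphism that fixes the starting vertex, so it
  -- preserves the distribution of the walk.
  Pt-orbital : ∀ t x y y′ → orbital gen d≤n x y ≡ orbital gen d≤n x y′ → Pt t x y ≡ Pt t x y′
  Pt-orbital t x y y′ e =
    let ρ , ρx≡x , ρy≡y′ = orbital-conjugate gen d≤n x y y′ e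
    in trans (sym (Pt-automorphism (actPermutation ρ) (actPermutation-automorphism ρ) t x y))
         (cong₂ (Pt t) ρx≡x ρy≡y′)

  -- Without edges `P` is the zero matrix, so no stationary distribution exists and `MixedBy` holds
  -- vacuously.
  edgeless⇒mixed : ∀ x → deg x ≡ 0 → ∀ ε → MixedBy ε 0
  edgeless⇒mixed x deg≡0 ε π (_ , mass , invariant) _ =
    contradiction (trans (sym (sum-zero π π≡0)) mass) (λ ())
    where
    P≡0 : ∀ y z → P y z ≡ 0ℚ
    P≡0 y z with adj n y z
    ... | true = cong inv (trans (deg-constant x y) deg≡0)
    ... | false = refl
    π≡0 : ∀ z → π z ≡ 0ℚ
    π≡0 z = trans (sym (invariant z))
      (sum-zero (λ y → π y * P y z) (λ y → trans (cong (π y *_) (P≡0 y z)) (ℚP.*-zeroʳ (π y))))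

  module WithDegree (x : Vx) (k : ℕ) (deg≡suc : deg x ≡ suc k) where

    open Regular k (λ y → trans (deg-constant x y) deg≡suc)

    -- If ρ maps z to x and fixes p, a walk from z to p followed by the reverse
    -- of its image under ρ leads from z to x.
    even-walk : ∀ z → ∃[ ℓ ] 0ℚ < Pt (ℓ ℕ.+ ℓ) z x
    even-walk z =
      let σ , σz≡x = transitive z x
          ρ , p , ρz≡σz , ρp≡p = fixing-a-point gen d≤n 3d≤n z σ
          ℓ , positive = Reach⇒0<Pt (connected n z p)
          moved = trans (sym (Pt-automorphism (actPermutation ρ) (actPermutation-automorphism ρ) ℓ z p))
                    (cong₂ (Pt ℓ) (trans ρz≡σz σz≡x) ρp≡p)
      in ℓ , 0<Pt-+ ℓ ℓ z p x positive (subst (0ℚ <_) (trans moved (Pt-sym ℓ x p)) positive)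

    private
      minor = minorization x even-walk

    open Minorized x (proj₁ minor) (proj₁ (proj₂ minor)) (proj₁ (proj₂ (proj₂ minor))) (proj₂ (proj₂ (proj₂ minor)))

    -- An automorphism taking `x` to `y` permutes the terms of the sum, so one starting vertex
    -- represents all.
    TV-constant : ∀ t y → TV uniform t y ≡ TV uniform t x
    TV-constant t y =
      let ρ , aut , ρx≡y = automorphism-to x y
      in trans (cong (TV uniform t) (sym ρx≡y)) (cong (½ *_)
           (trans (sum-permute (λ z → ∣ deviation t (ρ ⟨$⟩ʳ x) z ∣) ρ)
             (sum-cong (λ z → cong (λ p → ∣ p - inv (card n) ∣) (Pt-automorphism ρ aut t x z)))))

    close⇒mixed : ∀ ε t → TV uniform t x ≤ ε → MixedBy ε t
    close⇒mixed ε t close π π-stationary y = subst (_≤ ε)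
      (sym (trans (cong (½ *_) (norm-cong (λ z → cong (_-_ (Pt t y z)) (stationary-unique π π-stationary z))))
        (TV-constant t y)))
      close

    mixed⇒close : ∀ ε t → MixedBy ε t → TV uniform t x ≤ ε
    mixed⇒close ε t mixed = mixed uniform (uniform-stationary x) x

    -- Mixing has been reduced to a decidable inequality at the single vertex `x`, so a least time
    -- can be found by search.
    mixing-time : ∀ ε → 0ℚ < ε → ∃[ t ] IsMixingTime ε t
    mixing-time ε 0<ε = first (eventually-close x ε 0<ε)
      where
      first : ∃[ t ] TV uniform t x ≤ ε → ∃[ t ] IsMixingTime ε t
      first (t , close) =
        let m , m-close , minimal = least (λ s → TV uniform s x ℚP.≤? ε) t close
        in m , close⇒mixed ε m m-close , λ s mixed → minimal s (mixed⇒close ε s mixed)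

    -- Sampled every `h` steps, the walk would be nearly singular to uniform up to index `D` and
    -- nearly uniform from `D + 1` on, although its distributions satisfy a linear recurrence of
    -- length `D + 1`.
    no-abrupt-mixing-time :
      ∀ {ε} → ε ≤ inv (suc (suc D ℕ.* ((D ℕ.+ 3) ℕ.+ (D ℕ.+ 3)))) →
      ∀ {t s} → IsMixingTime ε t → IsMixingTime (1ℚ - ε) s →
      ∀ h → D ℕ.* h ℕ.< s → ¬ (t ℕ.≤ suc D ℕ.* h)
    no-abrupt-mixing-time {ε} ε≤ {t} {s} (t-mixed , _) (_ , s-least) h Dh<s t≤ =
      no-abrupt-mixing c m 0<c max u uniform (λ i → Pt-probability (i ℕ.* h) x) (uniform-probability x)
        recurrence ε (small-multiple (suc D) (D ℕ.+ 3) ε ε≤) early late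
      where
      u : ℕ → Vx → ℚ
      u i = Pt (i ℕ.* h) x
      v : Fin (suc D) → Vx → ℚ
      v j = u (toℕ j)
      dependence = linear-dependence-on-classes (orbital gen d≤n x) v
        (λ j → Pt-orbital (toℕ j ℕ.* h) x)
      c = proj₁ dependence
      m = proj₁ (proj₁ (proj₂ dependence))
      0<c = proj₁ (proj₂ (proj₁ (proj₂ dependence)))
      max = proj₂ (proj₂ (proj₁ (proj₂ dependence)))
      -- Running the walk for `r * h` further steps is linear, so the relation among the first
      -- `D + 1` samples persists.
      recurrence : ∀ r y → sumℚ (λ j → c j * u (toℕ j ℕ.+ r) y) ≡ 0ℚ
      recurrence r y = begin
        sumℚ (λ j → c j * u (toℕ j ℕ.+ r) y)
          ≡⟨ sum-cong (λ j → cong (c j *_) (trans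
               (cong (λ e → Pt e x y) (ℕP.*-distribʳ-+ h (toℕ j) r))
               (Pt-+ (toℕ j ℕ.* h) (r ℕ.* h) x y))) ⟩
        (c ⊛ (λ j → v j ⊛ Pt (r ℕ.* h))) y
          ≡⟨ ⊛-assoc c v (Pt (r ℕ.* h)) y ⟨
        ((c ⊛ v) ⊛ Pt (r ℕ.* h)) y
          ≡⟨ sum-zero (λ z → (c ⊛ v) z * Pt (r ℕ.* h) z y) (λ z →
               trans (cong (_* Pt (r ℕ.* h) z y) (proj₂ (proj₂ dependence) z)) (ℚP.*-zeroˡ (Pt (r ℕ.* h) z y))) ⟩
        0ℚ ∎
        where open ≡-Reasoning
      early : ∀ i → i ℕ.≤ D → 1ℚ - ε ≤ tv (u i) uniform
      -- These times precede the mixing time `s` to accuracy `1 - ε`, so the distance still exceeds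
      -- `1 - ε`.
      early i i≤D = ℚP.<⇒≤ (ℚP.≰⇒> (λ close →
        ℕP.<⇒≱ Dh<s (ℕP.≤-trans (s-least (i ℕ.* h) (close⇒mixed (1ℚ - ε) (i ℕ.* h) close)) (ℕP.*-monoˡ-≤ h i≤D))))
      late : ∀ i → D ℕ.< i → tv (u i) uniform ≤ ε
      late i D<i = ≤-trans (TV-antitone (ℕP.≤-trans t≤ (ℕP.*-monoˡ-≤ h D<i)) x) (mixed⇒close ε t t-mixed)

-- From the ratio condition to bounded mixing times

vertex-or-empty : ∀ m → (¬ Fin m) ⊎ Fin m
vertex-or-empty zero = inj₁ λ ()
vertex-or-empty (suc m) = inj₂ zero

theoremA : (G : FIGraph) → Connected G → Transitive G → ¬ Cutoff G
theoremA G connected ((d , gen) , N₁ , transitive) (slow , cutoff) = slow constant-time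
  where
  open FIGraph G
  D R K : ℕ
  D = FISetProperties.orbitalBound V gen
  R = suc (D ℕ.+ D)
  -- Chosen so that `suc K` is `R + R`, the tolerance that `time-scale` expects.
  K = (D ℕ.+ D) ℕ.+ R
  constant-time : MixesInEventuallyConstantTime G
  constant-time ε₀ (0<ε₀ , ε₀<1) = C , N , bounded
    where
    -- The accuracy below which `no-abrupt-mixing-time` applies. Taking the minimum with `ε₀` can
    -- only lengthen the mixing time, so bounding it at `ε` is enough.
    ε₁ = inv (suc (suc D ℕ.* ((D ℕ.+ 3) ℕ.+ (D ℕ.+ 3))))
    ε = ε₀ ℚ.⊓ ε₁
    ε≤ε₀ : ε ≤ ε₀
    ε≤ε₀ = ℚP.p⊓q≤p ε₀ ε₁
    0<ε : 0ℚ < ε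
    0<ε = 0<⊓ 0<ε₀ (0<inv (suc D ℕ.* ((D ℕ.+ 3) ℕ.+ (D ℕ.+ 3))))
    ε<1 : ε < 1ℚ
    ε<1 = ℚP.≤-<-trans ε≤ε₀ ε₀<1
    0<1-ε : 0ℚ < 1ℚ - ε
    0<1-ε = subst (_< 1ℚ - ε) (ℚP.+-inverseʳ ε) (ℚP.+-monoˡ-< (- ε) ε<1)
    cut = cutoff ε (0<ε , ε<1) (inv (suc K)) (0<inv K)
    C = 2 ℕ.* (suc (R ℕ.+ R) ℕ.* R)
    N = N₁ ℕ.+ (d ℕ.+ (d ℕ.+ d)) ℕ.+ proj₁ cut
    bounded : ∀ n → N ℕ.≤ n → ∀ t → SRW.IsMixingTime G n ε₀ t → t ℕ.≤ C
    bounded n N≤n t (t-mixed , t-least) = ℕP.≮⇒≥ λ C<t → on-vertex C<t (vertex-or-empty (card n))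
      where
      open SRW G n
      N₁+3d≤n = ℕP.≤-trans (ℕP.m≤m+n (N₁ ℕ.+ (d ℕ.+ (d ℕ.+ d))) (proj₁ cut)) N≤n
      N₁≤n = ℕP.≤-trans (ℕP.m≤m+n N₁ (d ℕ.+ (d ℕ.+ d))) N₁+3d≤n
      3d≤n = ℕP.≤-trans (ℕP.m≤n+m (d ℕ.+ (d ℕ.+ d)) N₁) N₁+3d≤n
      cut≤n = ℕP.≤-trans (ℕP.m≤n+m (proj₁ cut) (N₁ ℕ.+ (d ℕ.+ (d ℕ.+ d)))) N≤n
      module W = TransitiveWalk G connected gen n 3d≤n (transitive n N₁≤n)
      -- Disposes of graphs without vertices or without edges, which count as mixed at time 0.
      not-mixed-at-0 : C ℕ.< t → ¬ MixedBy ε₀ 0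
      not-mixed-at-0 C<t mixed = ℕP.<⇒≱ C<t (ℕP.≤-trans (t-least 0 mixed) ℕ.z≤n)
      on-degree : C ℕ.< t → ∀ x k → deg x ≡ k → ⊥
      on-degree C<t x zero deg≡0 = not-mixed-at-0 C<t (W.edgeless⇒mixed x deg≡0 ε₀)
      on-degree C<t x (suc k) deg≡ = separate (X.mixing-time ε 0<ε) (X.mixing-time (1ℚ - ε) 0<1-ε)
        where
        module X = W.WithDegree x k deg≡
        separate : ∃[ t′ ] IsMixingTime ε t′ → ∃[ s ] IsMixingTime (1ℚ - ε) s → ⊥
        separate (t′ , t′-mixing) (s , s-mixing) =
          -- Mixing to accuracy `ε` implies mixing to `ε₀`, so `t′` exceeds `C` as well and a
          -- separating step length exists.
          let t≤t′ = t-least t′ (λ π st y → ≤-trans (proj₁ t′-mixing π st y) ε≤ε₀)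
              h , Dh<s , t′≤ = time-scale D t′ s
                (ratio-bound K t′ s (proj₂ cut n cut≤n t′ s t′-mixing s-mixing))
                (ℕP.<-≤-trans C<t t≤t′)
          in X.no-abrupt-mixing-time (ℚP.p⊓q≤q ε₀ ε₁) t′-mixing s-mixing h Dh<s t′≤
      on-vertex : C ℕ.< t → (¬ Vx) ⊎ Vx → ⊥
      on-vertex C<t (inj₁ empty) = not-mixed-at-0 C<t (λ π _ y → contradiction y empty)
      on-vertex C<t (inj₂ x) = on-degree C<t x (deg x) refl
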